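{- Let $R$ be a commutative Noetherian ring with unit, let $S$ be a finite set of ideals of $R$, and let $g\ge 0$ be a fixed integer. Then the $\mathcal{G}_{g,S}^{\mathrm{op}}$-module $\mathrm{Spl}_R$ is finitely generated. In particular, there exists a finite set $\{(G_i,\alpha_i)\}_i$ of edge-labeled graphs of genus $g$, depending only on $R$, $S$ and $g$, such that for every edge-labeled graph $(G,\alpha)$ of genus $g$ (with labels in $S$), the module of generalized splines $\mathrm{Spl}_R(G,\alpha)$ is generated as an $R$-module by the images of the modules $\mathrm{Spl}_R(G_i,\alpha_i)$ under the maps $\varphi^*$ induced by contractions $\varphi\colon(G,\alpha)\to(G_i,\alpha_i)$.
   Context: A graph $G$ consists of a finite vertex set $V_G$, a finite edge set $E_G$, and a boundary map $\partial$ sending each edge to its endpoints (an unordered pair of distinct vertices, or a single vertex if the edge is a loop) and each vertex to itself; multiple edges and loops are allowed. All graphs are connected. The (combinatorial) genus is $g=|E_G|-|V_G|+1$. An edge-labeled graph is a pair $(G,\alpha)$ with $\alpha\colon E_G\to S$ a map. A contraction $(G,\alpha)\to(G',\alpha')$ is a map $\varphi\colon V_G\sqcup E_G\to V_{G'}\sqcup E_{G'}$ such that: (1) $\varphi(V_G)=V_{G'}$; (2) $\varphi(\partial(e))=\partial(\varphi(e))$ for all $e\in E_G$ (where a pair of endpoints with the same image is identified with that single vertex); (3) $\varphi$ restricts to a bijection $\varphi^{ -1}(E_{G'})\to E_{G'}$, and $\alpha'(\varphi(e))=\alpha(e)$ for all $e\in\varphi^{ -1}(E_{G'})$; (4) for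 every $v\in V_{G'}$, the preimage $\varphi^{ -1}(v)$ is a subtree of $G$. $\mathcal{G}_{g,S}$ is the category of edge-labeled graphs of genus $g$ with labels in $S$, with contractions as morphisms. A $\mathcal{G}_{g,S}^{\mathrm{op}}$-module over $R$ is a covariant functor $M$ from $\mathcal{G}_{g,S}^{\mathrm{op}}$ to finitely generated $R$-modules. It is finitely generated if there is a finite list of objects $(G_i,\alpha_i)$ such that for every object $(G,\alpha)$, $M(G,\alpha)$ is spanned by the images of the $M(G_i,\alpha_i)$ under the maps induced by contractions $(G,\alpha)\to(G_i,\alpha_i)$. The module of generalized splines $\mathrm{Spl}_R(G,\alpha)$ is the $R$-submodule of $\bigoplus_{v\in V_G}R$ of all $\mathbf p$ with $\mathbf p_u-\mathbf p_v\in\alpha(e)$ for every edge $e$ with $\partial(e)=\{u,v\}$. A contraction $\varphi\colon(G,\alpha)\to(G',\alpha')$ induces $\varphi^*\colon\mathrm{Spl}_R(G',\alpha')\to\mathrm{Spl}_R(G,\alpha)$, $(\mathbf p_v)_{v\in V_{G'}}\mapsto(\mathbf p_{\varphi(w)})_{w\in V_G}$. These maps make $(G,\alpha)\mapsto\mathrm{Spl}_R(G,\alpha)$ into a $\mathcal{G}_{g,S}^{\mathrm{op}}$-module, denoted $\mathrm{Spl}_R$. -}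

module Defs where

open import Algebra.Bundles using (CommutativeRing)
open import Algebra.Module.Bundles using (Module)
import Algebra.Module.Construct.TensorUnit as TensorUnit
open import Algebra.Module.Morphism.Structures using (IsModuleHomomorphism)
open import Algebra.Module.Structures.Biased using (IsModuleFromLeft)
import Algebra.Properties.AbelianGroup as AbelianGroupProperties
import Algebra.Properties.Monoid.Sum as Sum
open import Data.Empty using (⊥-elim)
open import Data.Fin.Base using (Fin; zero; suc; splitAt; _↑ˡ_; _↑ʳ_)
open import Data.Fin.Properties using (_≟_; splitAt-↑ˡ; splitAt-↑ʳ)
open import Data.Integer.Base as ℤ using (ℤ; +_; 1ℤ)
open import Data.List.Base using (List; []; _∷_)
open import Data.List.Membership.Propositional using (_∈_; _∉_)
import Data.List.Membership.DecPropositional as DecMembership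
open import Data.List.Relation.Binary.Subset.Propositional using (_⊆_)
open import Data.List.Relation.Unary.All as All using (All; []; _∷_)
open import Data.List.Relation.Unary.All.Properties using (¬Any⇒All¬)
open import Data.List.Relation.Unary.AllPairs using ([]; _∷_)
open import Data.List.Relation.Unary.Any using (Any; here; there)
open import Data.List.Relation.Unary.Unique.Propositional using (Unique)
open import Data.Nat.Base as ℕ using (ℕ; zero; suc)
open import Data.Product.Base using (∃-syntax; Σ-syntax; _×_; _,_; proj₁; proj₂)
open import Data.Product using (∃!)
open import Data.Sum.Base using (_⊎_; inj₁; inj₂; [_,_]′)
open import Data.Sum.Properties using (inj₁-injective; inj₂-injective)
open import Data.Vec.Functional using (Vector)
open import Function.Base using (_∘_; id)
open import Function.Bundles using (_⇔_; mk⇔; Equivalence)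
open import Level using (_⊔_; 0ℓ) renaming (suc to lsuc)
open import Relation.Binary.PropositionalEquality.Core
  using (_≡_; _≢_; refl; sym; trans; cong; subst)
open import Relation.Nullary using (¬_; yes; no)
open import Relation.Unary using (Pred; _≐_; U)

-- Vertices and edges are numbered.  The endpoints of an edge are stored as
-- an ordered pair, but only ∂ and Joins below ever inspect it, so that the
-- order carries no information; a loop has two equal components.
record Graph : Set where
  field
    #V   : ℕ
    #E   : ℕ
    ends : Fin #E → Fin #V × Fin #V

  Vertex : Set
  Vertex = Fin #V

  Edge : Set
  Edge = Fin #E

  Cell : Set
  Cell = Vertex ⊎ Edge

  -- The boundary of a cell as a set of vertices.
  ∂ : Cell → Pred Vertex 0ℓ
  ∂ (inj₁ v) w = w ≡ v
  ∂ (inj₂ e) w = w ≡ proj₁ (ends e) ⊎ w ≡ proj₂ (ends e)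

  Joins : Edge → Vertex → Vertex → Set
  Joins e u v = ends e ≡ (u , v) ⊎ ends e ≡ (v , u)

  data Walk : Vertex → Vertex → Set where
    nil  : ∀ {v} → Walk v v
    cons : ∀ {u v w} (e : Edge) → Joins e u v → Walk v w → Walk u w

  edges : ∀ {u v} → Walk u v → List Edge
  edges nil          = []
  edges (cons e _ w) = e ∷ edges w

  -- The vertices visited by a walk, its final vertex excluded.
  starts : ∀ {u v} → Walk u v → List Vertex
  starts nil              = []
  starts (cons {u} _ _ w) = u ∷ starts w

  -- A loop is a cycle with one edge, two parallel edges form a cycle with
  -- two edges.
  record IsCycle {v} (w : Walk v v) : Set where
    field
      nonempty     : edges w ≢ []
      edgesUnique  : Unique (edges w)
      startsUnique : Unique (starts w)

  _Within_ : ∀ {u v} → Walk u v → Pred Cell 0ℓ → Set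
  w Within H = All (H ∘ inj₂) (edges w)

  record IsSubgraph (H : Pred Cell 0ℓ) : Set where
    field
      closed : ∀ {e v} → H (inj₂ e) → ∂ (inj₂ e) v → H (inj₁ v)

  record IsConnected (H : Pred Cell 0ℓ) : Set where
    field
      inhabited : ∃[ v ] H (inj₁ v)
      walk      : ∀ {u v} → H (inj₁ u) → H (inj₁ v) → Σ[ w ∈ Walk u v ] w Within H

  IsAcyclic : Pred Cell 0ℓ → Set
  IsAcyclic H = ∀ {v} (w : Walk v v) → IsCycle w → ¬ w Within H

  record IsSubtree (H : Pred Cell 0ℓ) : Set where
    field
      isSubgraph  : IsSubgraph H
      isConnected : IsConnected H
      isAcyclic   : IsAcyclic H

    open IsSubgraph isSubgraph public
    open IsConnected isConnected public

  genus : ℤ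
  genus = (+ #E) ℤ.- (+ #V) ℤ.+ 1ℤ

record LabeledGraph (g : ℕ) (L : Set) : Set where
  field
    graph     : Graph
    connected : Graph.IsConnected graph U
    genus≡g   : Graph.genus graph ≡ + g
    label     : Graph.Edge graph → L

  open Graph graph public

module _ {g : ℕ} {L : Set} where

  record Contraction (G G′ : LabeledGraph g L) : Set where
    private
      module G  = LabeledGraph G
      module G′ = LabeledGraph G′
    field
      map : G.Cell → G′.Cell

      map-vertex      : ∀ v → ∃[ v′ ] map (inj₁ v) ≡ inj₁ v′
      map-vertex-onto : ∀ v′ → ∃[ v ] map (inj₁ v) ≡ inj₁ v′

      map-∂ : ∀ e v′ → (∃[ v ] G.∂ (inj₂ e) v × map (inj₁ v) ≡ inj₁ v′)
                         ⇔ G′.∂ (map (inj₂ e)) v′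

      map-edge-bijective : ∀ e′ → ∃! _≡_ (λ e → map (inj₂ e) ≡ inj₂ e′)
      map-label          : ∀ {e e′} → map (inj₂ e) ≡ inj₂ e′ → G′.label e′ ≡ G.label e

      fibre-subtree : ∀ v′ → G.IsSubtree (λ x → map x ≡ inj₁ v′)

    vertexMap : G.Vertex → G′.Vertex
    vertexMap v = proj₁ (map-vertex v)

  open Contraction

  identity : ∀ {G} → Contraction G G
  identity {G} = record
    { map                = id
    ; map-vertex         = λ v → v , refl
    ; map-vertex-onto    = λ v → v , refl
    ; map-∂              = λ e v′ → mk⇔ (λ { (v , v∈∂ , refl) → v∈∂ }) (λ v′∈∂ → v′ , v′∈∂ , refl)
    ; map-edge-bijective = λ e → e , refl , sym ∘ inj₂-injective
    ; map-label          = λ { refl → refl }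
    ; fibre-subtree      = λ v → record
      { isSubgraph  = record { closed = λ () }
      ; isConnected = record
        { inhabited = v , refl
        ; walk      = λ { refl refl → nil , [] }
        }
      ; isAcyclic   = λ { nil c _ → IsCycle.nonempty c refl ; (cons _ _ _) _ (() ∷ _) }
      }
    }
    where open LabeledGraph G

-- A closed walk with distinct edges contains a cycle.
module Trails (G : Graph) where
  open Graph G
  open DecMembership (_≟_ {#V}) using (_∈?_)

  vertices : ∀ {u v} → Walk u v → List Vertex
  vertices {v = v} nil      = v ∷ []
  vertices (cons {u} _ _ w) = u ∷ vertices w

  unique-⊆ : ∀ {A : Set} {x : A} {xs ys} → xs ⊆ ys → All (x ≢_) ys → All (x ≢_) xs
  unique-⊆ xs⊆ys x∉ys = All.tabulate (All.lookup x∉ys ∘ xs⊆ys)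

  ∷-⊆ : ∀ {A : Set} {x : A} {xs ys} → xs ⊆ ys → (x ∷ xs) ⊆ (x ∷ ys)
  ∷-⊆ s (here p)  = here p
  ∷-⊆ s (there p) = there (s p)

  start∈ : ∀ {u v} (w : Walk u v) → u ∈ vertices w
  start∈ nil          = here refl
  start∈ (cons _ _ _) = here refl

  end∈ : ∀ {u v} (w : Walk u v) → v ∈ vertices w
  end∈ nil          = here refl
  end∈ (cons _ _ w) = there (end∈ w)

  starts⊆vertices : ∀ {u v} (w : Walk u v) → starts w ⊆ vertices w
  starts⊆vertices (cons _ _ w) = ∷-⊆ (starts⊆vertices w)

  starts-unique : ∀ {u v} (w : Walk u v) → Unique (vertices w) →
                  Unique (starts w) × v ∉ starts w
  starts-unique nil _ = [] , λ ()
  starts-unique (cons e j w) (u∉w ∷ uniq) with starts-unique w uniq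
  ... | us , v∉ = unique-⊆ (starts⊆vertices w) u∉w ∷ us
                , λ { (here refl) → All.lookup u∉w (end∈ w) refl ; (there v∈) → v∉ v∈ }

  prefix : ∀ {x v u} (w : Walk x v) → u ∈ vertices w →
           Unique (vertices w) → Unique (edges w) →
           Σ[ p ∈ Walk x u ] vertices p ⊆ vertices w × edges p ⊆ edges w
                             × Unique (vertices p) × Unique (edges p)
  prefix nil (here refl) uv ue = nil , id , id , uv , ue
  prefix w@(cons _ _ _) (here refl) uv ue =
    nil , (λ { (here refl) → here refl }) , (λ ()) , [] ∷ [] , []
  prefix (cons e j w) (there u∈) (x∉ ∷ uv) (e∉ ∷ ue) with prefix w u∈ uv ue
  ... | p , v⊆ , e⊆ , uv′ , ue′ =
    cons e j p , ∷-⊆ v⊆ , ∷-⊆ e⊆ , unique-⊆ v⊆ x∉ ∷ uv′ , unique-⊆ e⊆ e∉ ∷ ue′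

  CycleIn : List Edge → Set
  CycleIn es = ∃[ v ] Σ[ c ∈ Walk v v ] IsCycle c × edges c ⊆ es

  cycle-or-path : ∀ {u v} (w : Walk u v) → Unique (edges w) →
                  CycleIn (edges w) ⊎ Unique (vertices w)
  cycle-or-path nil _ = inj₂ ([] ∷ [])
  cycle-or-path (cons {u} e j w) (e∉ ∷ ue) with cycle-or-path w ue
  ... | inj₁ (v , c , isC , c⊆) = inj₁ (v , c , isC , there ∘ c⊆)
  ... | inj₂ uv with u ∈? vertices w
  ...   | no u∉ = inj₂ (¬Any⇒All¬ _ u∉ ∷ uv)
  ...   | yes u∈ with prefix w u∈ uv ue
  ...     | p , v⊆ , e⊆ , uv′ , ue′ with starts-unique p uv′
  ...       | us , u∉ = inj₁ (u , cons e j p , isC , ∷-⊆ e⊆)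
    where
      isC : IsCycle (cons e j p)
      isC = record
        { nonempty     = λ ()
        ; edgesUnique  = unique-⊆ e⊆ e∉ ∷ ue′
        ; startsUnique = ¬Any⇒All¬ _ u∉ ∷ us
        }

  no-closed-trail : ∀ {H v} → IsAcyclic H → (w : Walk v v) → Unique (edges w) →
                    w Within H → edges w ≡ []
  no-closed-trail ac nil _ _ = refl
  no-closed-trail ac w@(cons _ _ w′) ue w⊆H with cycle-or-path w ue
  ... | inj₁ (_ , c , isC , c⊆) = ⊥-elim (ac c isC (All.tabulate (All.lookup w⊆H ∘ c⊆)))
  ... | inj₂ (v∉ ∷ _) = ⊥-elim (All.lookup v∉ (end∈ w′) refl)

module _ {g : ℕ} {L : Set} where

  open Contraction

  module ContractionProperties {G G′ : LabeledGraph g L} (φ : Contraction G G′) where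
    private
      module G  = LabeledGraph G
      module G′ = LabeledGraph G′

    ⟦_⟧ : G.Vertex → G′.Vertex
    ⟦_⟧ = vertexMap φ

    map-⟦⟧ : ∀ v → map φ (inj₁ v) ≡ inj₁ ⟦ v ⟧
    map-⟦⟧ v = proj₂ (map-vertex φ v)

    joins-∂ : ∀ {e u v} → G.Joins e u v → G.∂ (inj₂ e) u × G.∂ (inj₂ e) v
    joins-∂ (inj₁ eq) = inj₁ (sym (cong proj₁ eq)) , inj₂ (sym (cong proj₂ eq))
    joins-∂ (inj₂ eq) = inj₂ (sym (cong proj₂ eq)) , inj₁ (sym (cong proj₁ eq))

    contracted : ∀ {e u v v′} → G.Joins e u v → map φ (inj₂ e) ≡ inj₁ v′ →
                 ⟦ u ⟧ ≡ v′ × ⟦ v ⟧ ≡ v′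
    contracted {e} {u} {v} {v′} j eq = at u (proj₁ (joins-∂ j)) , at v (proj₂ (joins-∂ j))
      where
        at : ∀ w → G.∂ (inj₂ e) w → ⟦ w ⟧ ≡ v′
        at w w∈ = subst (λ c → G′.∂ c ⟦ w ⟧) eq
          (Equivalence.to (map-∂ φ e ⟦ w ⟧) (w , w∈ , map-⟦⟧ w))

    kept : ∀ {e e′ u v} → G.Joins e u v → map φ (inj₂ e) ≡ inj₂ e′ →
           G′.Joins e′ ⟦ u ⟧ ⟦ v ⟧
    kept {e} {e′} {u} {v} j eq = aux (to u (proj₁ (joins-∂ j))) (to v (proj₂ (joins-∂ j)))
                                     (from (inj₁ refl)) (from (inj₂ refl))
      where
        to : ∀ w → G.∂ (inj₂ e) w → G′.∂ (inj₂ e′) ⟦ w ⟧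
        to w w∈ = subst (λ c → G′.∂ c ⟦ w ⟧) eq
          (Equivalence.to (map-∂ φ e ⟦ w ⟧) (w , w∈ , map-⟦⟧ w))

        ends-of : ∀ {w} → G.∂ (inj₂ e) w → w ≡ u ⊎ w ≡ v
        ends-of = go j
          where
            go : ∀ {w} → G.Joins e u v → G.∂ (inj₂ e) w → w ≡ u ⊎ w ≡ v
            go (inj₁ p) (inj₁ q) = inj₁ (trans q (cong proj₁ p))
            go (inj₁ p) (inj₂ q) = inj₂ (trans q (cong proj₂ p))
            go (inj₂ p) (inj₁ q) = inj₂ (trans q (cong proj₁ p))
            go (inj₂ p) (inj₂ q) = inj₁ (trans q (cong proj₂ p))

        from : ∀ {w′} → G′.∂ (inj₂ e′) w′ → w′ ≡ ⟦ u ⟧ ⊎ w′ ≡ ⟦ v ⟧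
        from {w′} w′∈ with Equivalence.from (map-∂ φ e w′) (subst (λ c → G′.∂ c w′) (sym eq) w′∈)
        ... | w , w∈ , weq with ends-of w∈
        ...   | inj₁ refl = inj₁ (inj₁-injective (trans (sym weq) (map-⟦⟧ w)))
        ...   | inj₂ refl = inj₂ (inj₁-injective (trans (sym weq) (map-⟦⟧ w)))

        pair : ∀ {x y} → proj₁ (G′.ends e′) ≡ x → proj₂ (G′.ends e′) ≡ y → G′.ends e′ ≡ (x , y)
        pair refl refl = refl

        aux : G′.∂ (inj₂ e′) ⟦ u ⟧ → G′.∂ (inj₂ e′) ⟦ v ⟧ →
              proj₁ (G′.ends e′) ≡ ⟦ u ⟧ ⊎ proj₁ (G′.ends e′) ≡ ⟦ v ⟧ →
              proj₂ (G′.ends e′) ≡ ⟦ u ⟧ ⊎ proj₂ (G′.ends e′) ≡ ⟦ v ⟧ →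
              G′.Joins e′ ⟦ u ⟧ ⟦ v ⟧
        aux _ _ (inj₁ p) (inj₂ q) = inj₁ (pair p q)
        aux _ _ (inj₂ p) (inj₁ q) = inj₂ (pair p q)
        aux _ (inj₁ r) (inj₁ p) (inj₁ q) = inj₁ (pair p (trans q (trans (sym p) (sym r))))
        aux _ (inj₂ r) (inj₁ p) (inj₁ q) = inj₁ (pair p (sym r))
        aux (inj₁ r) _ (inj₂ p) (inj₂ q) = inj₁ (pair (sym r) q)
        aux (inj₂ r) _ (inj₂ p) (inj₂ q) = inj₁ (pair (trans p (trans (sym q) (sym r))) q)

    edge-injective : ∀ {e f e′} → map φ (inj₂ e) ≡ inj₂ e′ → map φ (inj₂ f) ≡ inj₂ e′ → e ≡ f
    edge-injective {e′ = e′} p q with map-edge-bijective φ e′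
    ... | _ , _ , uniq = trans (sym (uniq p)) (uniq q)

    record Projection {u v} (w : G.Walk u v) : Set where
      field
        walk′   : G′.Walk ⟦ u ⟧ ⟦ v ⟧
        origin  : ∀ {e′} → e′ ∈ G′.edges walk′ → ∃[ e ] e ∈ G.edges w × map φ (inj₂ e) ≡ inj₂ e′
        unique  : Unique (G.edges w) → Unique (G′.edges walk′)
        trivial : G′.edges walk′ ≡ [] → w G.Within (λ c → map φ c ≡ inj₁ ⟦ u ⟧)

    project : ∀ {u v} (w : G.Walk u v) → Projection w
    project G.nil = record
      { walk′ = G′.nil ; origin = λ () ; unique = λ _ → [] ; trivial = λ _ → [] }
    project {u} {v} (G.cons {v = x} e j w) with map φ (inj₂ e) in eq | project w
    ... | inj₁ c | r with contracted j eq
    ...   | refl , ⟦x⟧≡⟦u⟧ = record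
      { walk′   = subst (λ a → G′.Walk a ⟦ v ⟧) ⟦x⟧≡⟦u⟧ walk′
      ; origin  = λ e′∈ → let (f , f∈ , q) = origin (subst (_ ∈_) same e′∈) in f , there f∈ , q
      ; unique  = λ { (_ ∷ ue) → subst Unique (sym same) (unique ue) }
      ; trivial = λ em → eq ∷ subst (λ a → w G.Within (λ c → map φ c ≡ inj₁ a)) ⟦x⟧≡⟦u⟧
                                    (trivial (trans (sym same) em))
      }
      where
        open Projection r
        edges-subst : ∀ {a b} (p : a ≡ b) (w : G′.Walk a ⟦ v ⟧) →
                      G′.edges (subst (λ a → G′.Walk a ⟦ v ⟧) p w) ≡ G′.edges w
        edges-subst refl w = refl

        same : G′.edges (subst (λ a → G′.Walk a ⟦ v ⟧) ⟦x⟧≡⟦u⟧ walk′) ≡ G′.edges walk′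
        same = edges-subst ⟦x⟧≡⟦u⟧ walk′
    project {u} {v} (G.cons {v = x} e j w) | inj₂ e′ | r = record
      { walk′   = G′.cons e′ (kept j eq) walk′
      ; origin  = λ { (here refl) → e , here refl , eq
                    ; (there p) → let (f , f∈ , q) = origin p in f , there f∈ , q }
      ; unique  = λ { (e∉ ∷ ue) → All.tabulate (λ p → fresh e∉ p) ∷ unique ue }
      ; trivial = λ ()
      }
      where
        open Projection r
        fresh : ∀ {f′} → All (e ≢_) (G.edges w) → f′ ∈ G′.edges walk′ → e′ ≢ f′
        fresh e∉ p refl with origin p
        ... | f , f∈ , q = All.lookup e∉ f∈ (edge-injective eq q)

    -- Preimages of subtrees under contractions are subtrees.
    module Preimage {T : Pred G′.Cell 0ℓ} (T-subtree : G′.IsSubtree T) where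
      private
        module T = G′.IsSubtree T-subtree
        module F v′ = G.IsSubtree (fibre-subtree φ v′)

      H : Pred G.Cell 0ℓ
      H = T ∘ map φ

      within-fibre : ∀ {v′ a b} {w : G.Walk a b} → T (inj₁ v′) →
                     w G.Within (λ c → map φ c ≡ inj₁ v′) → w G.Within H
      within-fibre t = All.map (λ eq → subst T (sym eq) t)

      append : ∀ {a b c} (w : G.Walk a b) (w₂ : G.Walk b c) → w G.Within H → w₂ G.Within H →
               Σ[ w₃ ∈ G.Walk a c ] w₃ G.Within H
      append G.nil          w₂ _        q = w₂ , q
      append (G.cons e j w) w₂ (h ∷ p) q with append w w₂ p q
      ... | w₃ , r = G.cons e j w₃ , h ∷ r

      orient : ∀ {e e′ a b} → map φ (inj₂ e) ≡ inj₂ e′ → G′.Joins e′ a b →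
               ∃[ p ] ∃[ q ] G.Joins e p q × ⟦ p ⟧ ≡ a × ⟦ q ⟧ ≡ b
      orient {e} {e′} {a} {b} eq j = go j (kept {u = p} {v = q} (inj₁ refl) eq)
        where
          p = proj₁ (G.ends e)
          q = proj₂ (G.ends e)
          go : G′.Joins e′ a b → G′.Joins e′ ⟦ p ⟧ ⟦ q ⟧ →
               ∃[ p ] ∃[ q ] G.Joins e p q × ⟦ p ⟧ ≡ a × ⟦ q ⟧ ≡ b
          go (inj₁ s) (inj₁ t) = p , q , inj₁ refl , cong proj₁ r , cong proj₂ r
            where r = trans (sym t) s
          go (inj₁ s) (inj₂ t) = q , p , inj₂ refl , cong proj₁ r , cong proj₂ r
            where r = trans (sym t) s
          go (inj₂ s) (inj₁ t) = q , p , inj₂ refl , cong proj₂ r , cong proj₁ r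
            where r = trans (sym t) s
          go (inj₂ s) (inj₂ t) = p , q , inj₁ refl , cong proj₂ r , cong proj₁ r
            where r = trans (sym t) s

      in-fibre : ∀ {v a} → ⟦ v ⟧ ≡ a → map φ (inj₁ v) ≡ inj₁ a
      in-fibre {v} eq = trans (map-⟦⟧ v) (cong inj₁ eq)

      lift : ∀ {a b u v} (w : G′.Walk a b) → w G′.Within T → T (inj₁ a) →
             ⟦ u ⟧ ≡ a → ⟦ v ⟧ ≡ b → Σ[ w ∈ G.Walk u v ] w G.Within H
      lift {a} G.nil _ ta eu ev with F.walk a (in-fibre eu) (in-fibre ev)
      ... | w , p = w , within-fibre ta p
      lift {a} {b} {u} {v} (G′.cons {v = x} e′ j w) (te ∷ tw) ta eu ev
        with map-edge-bijective φ e′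
      ... | e , eq , _ with orient eq j
      ... | p , q , je , ep , eq′
        with F.walk a (in-fibre eu) (in-fibre ep) | lift w tw tx eq′ ev
        where
          tx : T (inj₁ x)
          tx = T.closed te (end∂ j)
            where
              end∂ : G′.Joins e′ a x → G′.∂ (inj₂ e′) x
              end∂ (inj₁ s) = inj₂ (sym (cong proj₂ s))
              end∂ (inj₂ s) = inj₁ (sym (cong proj₁ s))
      ... | w₁ , h₁ | w₂ , h₂ =
        append w₁ (G.cons e je w₂) (within-fibre ta h₁) (subst T (sym eq) te ∷ h₂)

      subtree : G.IsSubtree H
      subtree = record
        { isSubgraph  = record { closed = λ {e} {v} → closed {e} {v} }
        ; isConnected = record
          { inhabited = let (v′ , t) = T.inhabited ; (v , eq) = map-vertex-onto φ v′
                        in v , subst T (sym eq) t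
          ; walk      = λ {u} {v} hu hv →
              let tu = subst T (map-⟦⟧ u) hu
                  (w , p) = T.walk tu (subst T (map-⟦⟧ v) hv)
              in lift w p tu refl refl
          }
        ; isAcyclic   = acyclic
        }
        where
          closed : ∀ {e v} → H (inj₂ e) → G.∂ (inj₂ e) v → H (inj₁ v)
          closed {e} {v} h v∈ = subst T (sym (map-⟦⟧ v)) (go (map φ (inj₂ e)) h
            (Equivalence.to (map-∂ φ e ⟦ v ⟧) (v , v∈ , map-⟦⟧ v)))
            where
              go : ∀ c → T c → G′.∂ c ⟦ v ⟧ → T (inj₁ ⟦ v ⟧)
              go (inj₁ _) t refl = t
              go (inj₂ _) t v′∈  = T.closed t v′∈

          acyclic : G.IsAcyclic H
          acyclic {v} w isC w⊆H =
            F.isAcyclic ⟦ v ⟧ w isC (trivial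
              (Trails.no-closed-trail G′.graph {H = T} T.isAcyclic walk′
                 (unique (G.IsCycle.edgesUnique isC))
                 (All.tabulate λ p → let (e , e∈ , eq) = origin p
                                     in subst T eq (All.lookup w⊆H e∈))))
            where open Projection (project w)

  infixr 9 _⊚_

  _⊚_ : ∀ {G G′ G″ : LabeledGraph g L} → Contraction G′ G″ → Contraction G G′ → Contraction G G″
  _⊚_ {G} {G′} {G″} ψ φ = record
    { map                = map ψ ∘ map φ
    ; map-vertex         = λ v → Ψ.⟦ Φ.⟦ v ⟧ ⟧ , vertex v
    ; map-vertex-onto    = λ v″ →
        let (v′ , p) = map-vertex-onto ψ v″ ; (v , q) = map-vertex-onto φ v′
        in v , trans (cong (map ψ) q) p
    ; map-∂              = λ e v″ → mk⇔ (to e v″) (from e v″)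
    ; map-edge-bijective = λ e″ →
        let (e′ , p , p!) = map-edge-bijective ψ e″ ; (e , q , q!) = map-edge-bijective φ e′
        in e , trans (cong (map ψ) q) p , λ {f} r → unique-lift p! q! f r
    ; map-label          = λ {e} r → label e r
    ; fibre-subtree      = λ v″ → Φ.Preimage.subtree (fibre-subtree ψ v″)
    }
    where
      module G  = LabeledGraph G
      module G′ = LabeledGraph G′
      module G″ = LabeledGraph G″
      module Φ  = ContractionProperties φ
      module Ψ  = ContractionProperties ψ

      vertex : ∀ v → map ψ (map φ (inj₁ v)) ≡ inj₁ Ψ.⟦ Φ.⟦ v ⟧ ⟧
      vertex v = trans (cong (map ψ) (Φ.map-⟦⟧ v)) (Ψ.map-⟦⟧ _)

      vertex-not-edge : ∀ {v′ e″} → map ψ (inj₁ v′) ≢ inj₂ e″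
      vertex-not-edge {v′} r with trans (sym r) (Ψ.map-⟦⟧ v′)
      ... | ()

      to : ∀ e v″ → (∃[ v ] G.∂ (inj₂ e) v × map ψ (map φ (inj₁ v)) ≡ inj₁ v″) →
           G″.∂ (map ψ (map φ (inj₂ e))) v″
      to e v″ (v , v∈ , r) = go (map φ (inj₂ e))
          (Equivalence.to (map-∂ φ e Φ.⟦ v ⟧) (v , v∈ , Φ.map-⟦⟧ v))
        where
          r′ : map ψ (inj₁ Φ.⟦ v ⟧) ≡ inj₁ v″
          r′ = trans (cong (map ψ) (sym (Φ.map-⟦⟧ v))) r

          go : ∀ c → G′.∂ c Φ.⟦ v ⟧ → G″.∂ (map ψ c) v″
          go (inj₁ _)  refl = subst (λ c → G″.∂ c v″) (sym r′) refl
          go (inj₂ e′) v′∈  = Equivalence.to (map-∂ ψ e′ v″) (_ , v′∈ , r′)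

      from : ∀ e v″ → G″.∂ (map ψ (map φ (inj₂ e))) v″ →
             ∃[ v ] G.∂ (inj₂ e) v × map ψ (map φ (inj₁ v)) ≡ inj₁ v″
      from e v″ h with below (map φ (inj₂ e)) h
        where
          below : ∀ c → G″.∂ (map ψ c) v″ → ∃[ v′ ] G′.∂ c v′ × map ψ (inj₁ v′) ≡ inj₁ v″
          below (inj₁ v′) h = v′ , refl , trans (Ψ.map-⟦⟧ v′)
            (cong inj₁ (sym (subst (λ c → G″.∂ c v″) (Ψ.map-⟦⟧ v′) h)))
          below (inj₂ e′) h = Equivalence.from (map-∂ ψ e′ v″) h
      ... | v′ , v′∈ , r with Equivalence.from (map-∂ φ e v′) v′∈
      ...   | v , v∈ , q = v , v∈ , trans (cong (map ψ) q) r

      unique-lift : ∀ {e e′ e″} →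
                    (∀ {f′} → map ψ (inj₂ f′) ≡ inj₂ e″ → e′ ≡ f′) →
                    (∀ {f} → map φ (inj₂ f) ≡ inj₂ e′ → e ≡ f) →
                    ∀ f → map ψ (map φ (inj₂ f)) ≡ inj₂ e″ → e ≡ f
      unique-lift p! q! f r with map φ (inj₂ f) in eq
      ... | inj₁ v′ = ⊥-elim (vertex-not-edge r)
      ... | inj₂ f′ = q! (trans eq (cong inj₂ (sym (p! r))))

      label : ∀ e {e″} → map ψ (map φ (inj₂ e)) ≡ inj₂ e″ → G″.label e″ ≡ G.label e
      label e r with map φ (inj₂ e) in eq
      ... | inj₁ v′ = ⊥-elim (vertex-not-edge r)
      ... | inj₂ e′ = trans (map-label ψ r) (map-label φ eq)

module _ {c ℓ} {R : CommutativeRing c ℓ} {m ℓm} (M : Module R m ℓm) where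
  open CommutativeRing R using (Carrier)
  open Module M

  linearCombination : ∀ {n} → Vector Carrier n → Vector Carrierᴹ n → Carrierᴹ
  linearCombination r x = Sum.sum +ᴹ-monoid (λ i → r i *ₗ x i)

  Span : ∀ {p} → Pred Carrierᴹ p → Pred Carrierᴹ (c ⊔ m ⊔ ℓm ⊔ p)
  Span P x = ∃[ n ] Σ[ r ∈ Vector Carrier n ] Σ[ y ∈ Vector Carrierᴹ n ]
               (∀ i → P (y i)) × x ≈ᴹ linearCombination r y

  FinitelyGenerated : Set (c ⊔ m ⊔ ℓm)
  FinitelyGenerated = ∃[ n ] Σ[ y ∈ Vector Carrierᴹ n ] (∀ x →
                        Σ[ r ∈ Vector Carrier n ] x ≈ᴹ linearCombination r y)

  record Submodule p : Set (c ⊔ m ⊔ ℓm ⊔ lsuc p) where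
    field
      member : Pred Carrierᴹ p
      resp   : ∀ {x y} → x ≈ᴹ y → member x → member y
      0∈     : member 0ᴹ
      +∈     : ∀ {x y} → member x → member y → member (x +ᴹ y)
      *∈     : ∀ r {x} → member x → member (r *ₗ x)

  module _ {p} (N : Submodule p) where
    open Submodule N

    private
      module R = CommutativeRing R

    -∈ : ∀ {x} → member x → member (-ᴹ x)
    -∈ {x} x∈ = resp
      (uniqueˡ‿-ᴹ ((R.- R.1#) *ₗ x) x
        (≈ᴹ-trans (+ᴹ-congˡ (≈ᴹ-sym (*ₗ-identityˡ x)))
        (≈ᴹ-trans (≈ᴹ-sym (*ₗ-distribʳ x (R.- R.1#) R.1#))
        (≈ᴹ-trans (*ₗ-congʳ (R.-‿inverseˡ R.1#))
                  (*ₗ-zeroˡ x)))))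
      (*∈ (R.- R.1#) x∈)

    toModule : Module R (m ⊔ p) ℓm
    toModule = record
      { Carrierᴹ = Σ[ x ∈ Carrierᴹ ] member x
      ; _≈ᴹ_     = λ x y → proj₁ x ≈ᴹ proj₁ y
      ; _+ᴹ_     = λ (x , x∈) (y , y∈) → x +ᴹ y , +∈ x∈ y∈
      ; _*ₗ_     = λ r (x , x∈) → r *ₗ x , *∈ r x∈
      ; _*ᵣ_     = λ (x , x∈) r → r *ₗ x , *∈ r x∈
      ; 0ᴹ       = 0ᴹ , 0∈
      ; -ᴹ_      = λ (x , x∈) → -ᴹ x , -∈ x∈
      ; isModule = IsModuleFromLeft.isModule {commutativeRing = R} record
        { isLeftModule = record
          { isLeftSemimodule = record
            { +ᴹ-isCommutativeMonoid = record
              { isMonoid = record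
                { isSemigroup = record
                  { isMagma = record
                    { isEquivalence = record
                      { refl  = ≈ᴹ-refl
                      ; sym   = ≈ᴹ-sym
                      ; trans = ≈ᴹ-trans
                      }
                    ; ∙-cong = +ᴹ-cong
                    }
                  ; assoc = λ _ _ _ → +ᴹ-assoc _ _ _
                  }
                ; identity = (λ _ → +ᴹ-identityˡ _) , (λ _ → +ᴹ-identityʳ _)
                }
              ; comm = λ _ _ → +ᴹ-comm _ _
              }
            ; isPreleftSemimodule = record
              { *ₗ-cong      = *ₗ-cong
              ; *ₗ-zeroˡ     = λ _ → *ₗ-zeroˡ _
              ; *ₗ-distribʳ  = λ _ _ _ → *ₗ-distribʳ _ _ _
              ; *ₗ-identityˡ = λ _ → *ₗ-identityˡ _
              ; *ₗ-assoc     = λ _ _ _ → *ₗ-assoc _ _ _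
              ; *ₗ-zeroʳ     = λ _ → *ₗ-zeroʳ _
              ; *ₗ-distribˡ  = λ _ _ _ → *ₗ-distribˡ _ _ _
              }
            }
          ; -ᴹ‿cong    = -ᴹ‿cong
          ; -ᴹ‿inverse = (λ _ → -ᴹ‿inverseˡ _) , (λ _ → -ᴹ‿inverseʳ _)
          }
        }
      }

module _ {c ℓ} (R : CommutativeRing c ℓ) where
  open CommutativeRing R hiding (zero; refl; sym; trans)

  Ideal : ∀ p → Set (c ⊔ ℓ ⊔ lsuc p)
  Ideal p = Submodule (TensorUnit.⟨module⟩ {R = R}) p

  -- Ideals are predicates valued in Set (c ⊔ ℓ).  All ideals obtained from a
  -- family of such ideals by quantifying over Carrier and _≈_ stay there.
  Noetherian : Set (lsuc (c ⊔ ℓ))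
  Noetherian = ∀ (I : Ideal (c ⊔ ℓ)) → FinitelyGenerated (toModule TensorUnit.⟨module⟩ I)

  record FiniteSetOfIdeals : Set (lsuc (c ⊔ ℓ)) where
    field
      size     : ℕ
      ideal    : Fin size → Ideal (c ⊔ ℓ)
      distinct : ∀ {i j} → Submodule.member (ideal i) ≐ Submodule.member (ideal j) → i ≡ j

    Label : Set
    Label = Fin size

  FreeModule : ℕ → Module R c ℓ
  FreeModule n = record
    { Carrierᴹ = Vector Carrier n
    ; _≈ᴹ_     = λ x y → ∀ i → x i ≈ y i
    ; _+ᴹ_     = λ x y i → x i + y i
    ; _*ₗ_     = λ r x i → r * x i
    ; _*ᵣ_     = λ x r i → r * x i
    ; 0ᴹ       = λ _ → 0#
    ; -ᴹ_      = λ x i → - x i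
    ; isModule = IsModuleFromLeft.isModule {commutativeRing = R} record
      { isLeftModule = record
        { isLeftSemimodule = record
          { +ᴹ-isCommutativeMonoid = record
            { isMonoid = record
              { isSemigroup = record
                { isMagma = record
                  { isEquivalence = record
                    { refl  = λ _ → ≈-refl
                    ; sym   = λ p i → ≈-sym (p i)
                    ; trans = λ p q i → ≈-trans (p i) (q i)
                    }
                  ; ∙-cong = λ p q i → +-cong (p i) (q i)
                  }
                ; assoc = λ _ _ _ _ → +-assoc _ _ _
                }
              ; identity = (λ _ _ → +-identityˡ _) , (λ _ _ → +-identityʳ _)
              }
            ; comm = λ _ _ _ → +-comm _ _
            }
          ; isPreleftSemimodule = record
            { *ₗ-cong      = λ p q i → *-cong p (q i)
            ; *ₗ-zeroˡ     = λ _ _ → zeroˡ _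
            ; *ₗ-distribʳ  = λ _ _ _ _ → distribʳ _ _ _
            ; *ₗ-identityˡ = λ _ _ → *-identityˡ _
            ; *ₗ-assoc     = λ _ _ _ _ → *-assoc _ _ _
            ; *ₗ-zeroʳ     = λ _ _ → zeroʳ _
            ; *ₗ-distribˡ  = λ _ _ _ _ → distribˡ _ _ _
            }
          }
        ; -ᴹ‿cong    = λ p i → -‿cong (p i)
        ; -ᴹ‿inverse = (λ _ _ → -‿inverseˡ _) , (λ _ _ → -‿inverseʳ _)
        }
      }
    }
    where open CommutativeRing R using () renaming (refl to ≈-refl; sym to ≈-sym; trans to ≈-trans)

  module NoetherianProperties (noetherian : Noetherian) where
    private
      module ≈ = CommutativeRing R using (refl; sym; trans)

    open import Relation.Binary.Reasoning.Setoid setoid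
    open AbelianGroupProperties +-abelianGroup using (xyx⁻¹≈y)
    open Sum +-monoid using (sum)

    Sub : ℕ → Set (lsuc (c ⊔ ℓ))
    Sub n = Submodule (FreeModule n) (c ⊔ ℓ)

    coordinate : ∀ {n k} (N : Sub n) (r : Vector Carrier k) y i →
                 proj₁ (linearCombination (toModule (FreeModule n) N) r y) i
                   ≈ sum (λ j → r j * proj₁ (y j) i)
    coordinate {k = zero}  N r y i = ≈.refl
    coordinate {k = suc k} N r y i = +-congˡ (coordinate N (r ∘ suc) (y ∘ suc) i)

    scalar : ∀ {k} (I : Ideal (c ⊔ ℓ)) (r : Vector Carrier k) y →
             proj₁ (linearCombination (toModule TensorUnit.⟨module⟩ I) r y)
               ≈ sum (λ j → r j * proj₁ (y j))
    scalar {k = zero}  I r y = ≈.refl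
    scalar {k = suc k} I r y = +-congˡ (scalar I (r ∘ suc) (y ∘ suc))

    sum-cong : ∀ {k} {f g : Vector Carrier k} → (∀ i → f i ≈ g i) → sum f ≈ sum g
    sum-cong = Sum.sum-cong-≋ +-monoid

    sum-split : ∀ k {l} (f : Vector Carrier (k ℕ.+ l)) →
                sum f ≈ sum (λ i → f (i ↑ˡ l)) + sum (λ j → f (k ↑ʳ j))
    sum-split zero    f = ≈.sym (+-identityˡ _)
    sum-split (suc k) f = ≈.trans (+-congˡ (sum-split k (f ∘ suc))) (≈.sym (+-assoc _ _ _))

    sum-zero : ∀ {k} (f : Vector Carrier k) → (∀ i → f i ≈ 0#) → sum f ≈ 0#
    sum-zero {zero}  f p = ≈.refl
    sum-zero {suc k} f p = ≈.trans (+-cong (p zero) (sum-zero (f ∘ suc) (p ∘ suc))) (+-identityˡ 0#)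

    0∷_ : ∀ {n} → Vector Carrier n → Vector Carrier (suc n)
    (0∷ q) zero    = 0#
    (0∷ q) (suc i) = q i

    leading : ∀ {n} → Sub (suc n) → Ideal (c ⊔ ℓ)
    leading N = record
      { member = λ a → Σ[ p ∈ Vector Carrier _ ] member p × p zero ≈ a
      ; resp   = λ a≈b (p , p∈ , p≈a) → p , p∈ , ≈.trans p≈a a≈b
      ; 0∈     = _ , 0∈ , ≈.refl
      ; +∈     = λ (p , p∈ , p≈) (q , q∈ , q≈) → _ , +∈ p∈ q∈ , +-cong p≈ q≈
      ; *∈     = λ r (p , p∈ , p≈) → _ , *∈ r p∈ , *-congˡ p≈
      }
      where open Submodule N

    rest : ∀ {n} → Sub (suc n) → Sub n
    rest N = record
      { member = λ q → member (0∷ q)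
      ; resp   = λ x≈y → resp λ { zero → ≈.refl ; (suc i) → x≈y i }
      ; 0∈     = resp (λ { zero → ≈.refl ; (suc i) → ≈.refl }) 0∈
      ; +∈     = λ p q → resp (λ { zero → +-identityˡ 0# ; (suc i) → ≈.refl }) (+∈ p q)
      ; *∈     = λ r p → resp (λ { zero → zeroʳ r ; (suc i) → ≈.refl }) (*∈ r p)
      }
      where open Submodule N

    submodule-fg : ∀ {n} (N : Sub n) → FinitelyGenerated (toModule (FreeModule n) N)
    submodule-fg {zero}  N = 0 , (λ ()) , λ x → (λ ()) , λ ()
    submodule-fg {suc n} N with noetherian (leading N) | submodule-fg (rest N)
    ... | k , a , a-gen | l , q , q-gen = k ℕ.+ l , gens , λ x → coeffs x , correct x
      where
        N′ = toModule (FreeModule (suc n)) N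
        open Submodule N

        E = Σ[ x ∈ Vector Carrier (suc n) ] member x

        p : Fin k → E
        p i = proj₁ (proj₂ (a i)) , proj₁ (proj₂ (proj₂ (a i)))

        p≈a : ∀ i → proj₁ (p i) zero ≈ proj₁ (a i)
        p≈a i = proj₂ (proj₂ (proj₂ (a i)))

        q⁺ : Fin l → E
        q⁺ j = 0∷ proj₁ (q j) , proj₂ (q j)

        gens : Fin (k ℕ.+ l) → E
        gens = [ p , q⁺ ]′ ∘ splitAt k

        module _ (x : E) where
          lead = a-gen (proj₁ x zero , proj₁ x , proj₂ x , ≈.refl)

          r : Vector Carrier k
          r = proj₁ lead

          s : E
          s = linearCombination N′ r p

          x-s : Vector Carrier (suc n)
          x-s i = proj₁ x i + - proj₁ s i

          s₀ : proj₁ s zero ≈ proj₁ x zero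
          s₀ = begin
            proj₁ s zero                      ≈⟨ coordinate N r p zero ⟩
            sum (λ i → r i * proj₁ (p i) zero) ≈⟨ sum-cong (λ i → *-congˡ (p≈a i)) ⟩
            sum (λ i → r i * proj₁ (a i))      ≈⟨ scalar (leading N) r a ⟨
            proj₁ (linearCombination (toModule TensorUnit.⟨module⟩ (leading N)) r a)
                                               ≈⟨ proj₂ lead ⟨
            proj₁ x zero                       ∎

          tail∈ : member (0∷ (x-s ∘ suc))
          tail∈ = resp (λ { zero → ≈.trans (+-congˡ (-‿cong s₀)) (-‿inverseʳ _)
                          ; (suc i) → ≈.refl })
                       (+∈ (proj₂ x) (-∈ (FreeModule (suc n)) N (proj₂ s)))

          t = q-gen (x-s ∘ suc , tail∈)

          coeffs : Vector Carrier (k ℕ.+ l)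
          coeffs = [ r , proj₁ t ]′ ∘ splitAt k

          term : Fin (suc n) → Fin k ⊎ Fin l → Carrier
          term i c = [ r , proj₁ t ]′ c * proj₁ ([ p , q⁺ ]′ c) i

          split : ∀ i → proj₁ (linearCombination N′ coeffs gens) i ≈
                    proj₁ s i + sum (λ j → proj₁ t j * proj₁ (q⁺ j) i)
          split i = begin
            proj₁ (linearCombination N′ coeffs gens) i
              ≈⟨ coordinate N coeffs gens i ⟩
            sum (term i ∘ splitAt k)
              ≈⟨ sum-split k (term i ∘ splitAt k) ⟩
            sum (λ j → term i (splitAt k (j ↑ˡ l))) + sum (λ j → term i (splitAt k (k ↑ʳ j)))
              ≈⟨ +-cong (sum-cong λ j → reflexive (cong (term i) (splitAt-↑ˡ k j l)))
                        (sum-cong λ j → reflexive (cong (term i) (splitAt-↑ʳ k l j))) ⟩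
            sum (λ j → r j * proj₁ (p j) i) + sum (λ j → proj₁ t j * proj₁ (q⁺ j) i)
              ≈⟨ +-congʳ (coordinate N r p i) ⟨
            proj₁ s i + sum (λ j → proj₁ t j * proj₁ (q⁺ j) i) ∎

          correct : ∀ i → proj₁ x i ≈ proj₁ (linearCombination N′ coeffs gens) i
          correct zero = begin
            proj₁ x zero       ≈⟨ s₀ ⟨
            proj₁ s zero       ≈⟨ +-identityʳ _ ⟨
            proj₁ s zero + 0#  ≈⟨ +-congˡ (sum-zero (λ j → proj₁ t j * 0#) (λ j → zeroʳ _)) ⟨
            proj₁ s zero + sum (λ j → proj₁ t j * 0#) ≈⟨ split zero ⟨
            proj₁ (linearCombination N′ coeffs gens) zero ∎
          correct (suc i) = begin
            proj₁ x (suc i)                          ≈⟨ xyx⁻¹≈y (proj₁ s (suc i)) _ ⟨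
            proj₁ s (suc i) + proj₁ x (suc i) + - proj₁ s (suc i) ≈⟨ +-assoc _ _ _ ⟩
            proj₁ s (suc i) + x-s (suc i)            ≈⟨ +-congˡ (proj₂ t i) ⟩
            proj₁ s (suc i) + proj₁ (linearCombination (toModule (FreeModule n) (rest N)) (proj₁ t) q) i
              ≈⟨ +-congˡ (coordinate (rest N) (proj₁ t) q i) ⟩
            proj₁ s (suc i) + sum (λ j → proj₁ t j * proj₁ (q j) i) ≈⟨ split (suc i) ⟨
            proj₁ (linearCombination N′ coeffs gens) (suc i) ∎

module _ {c ℓ} (R : CommutativeRing c ℓ) (g : ℕ) (L : Set) where

  record OpModule m ℓm : Set (c ⊔ ℓ ⊔ lsuc (m ⊔ ℓm)) where
    field
      obj    : LabeledGraph g L → Module R m ℓm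
      obj-fg : ∀ G → FinitelyGenerated (obj G)

    module Obj (G : LabeledGraph g L) = Module (obj G)
    open Obj using (Carrierᴹ; rawBimodule)

    field
      pullback : ∀ {G G′} → Contraction G G′ → Carrierᴹ G′ → Carrierᴹ G

      pullback-homomorphism : ∀ {G G′} (φ : Contraction G G′) →
        IsModuleHomomorphism (rawBimodule G′) (rawBimodule G) (pullback φ)

      -- Contractions are equal when their maps on cells are.
      pullback-resp : ∀ {G G′} {φ ψ : Contraction G G′} →
        (∀ x → Contraction.map φ x ≡ Contraction.map ψ x) →
        ∀ p → Obj._≈ᴹ_ G (pullback φ p) (pullback ψ p)

      pullback-identity : ∀ {G} p → Obj._≈ᴹ_ G (pullback identity p) p

      pullback-⊚ : ∀ {G G′ G″} (ψ : Contraction G′ G″) (φ : Contraction G G′) p →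
        Obj._≈ᴹ_ G (pullback (ψ ⊚ φ) p) (pullback φ (pullback ψ p))

    ImageFrom : List (LabeledGraph g L) → ∀ G → Pred (Carrierᴹ G) (m ⊔ ℓm)
    ImageFrom Gs G y =
      Any (λ G′ → Σ[ φ ∈ Contraction G G′ ] Σ[ p ∈ Carrierᴹ G′ ] Obj._≈ᴹ_ G y (pullback φ p)) Gs

    IsFinitelyGenerated : Set (c ⊔ m ⊔ ℓm)
    IsFinitelyGenerated =
      Σ[ Gs ∈ List (LabeledGraph g L) ] ∀ G x → Span (obj G) (ImageFrom Gs G) x

module _ {c ℓ} (R : CommutativeRing c ℓ) (S : FiniteSetOfIdeals R) {g : ℕ} where
  open CommutativeRing R hiding (zero) renaming (refl to ≈-refl; sym to ≈-sym; trans to ≈-trans)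
  open FiniteSetOfIdeals S
  private
    module I i = Submodule (ideal i)

  module _ (G : LabeledGraph g Label) where
    open LabeledGraph G

    IsSpline : Pred (Vector Carrier #V) (c ⊔ ℓ)
    IsSpline p = ∀ {e u v} → Joins e u v → I.member (label e) (p u - p v)

    splines : Submodule (FreeModule R #V) (c ⊔ ℓ)
    splines = record
      { member = IsSpline
      ; resp   = λ x≈y s {e} j → I.resp (label e) (+-cong (x≈y _) (-‿cong (x≈y _))) (s j)
      ; 0∈     = λ {e} j → I.resp (label e) (≈-sym (-‿inverseʳ 0#)) (I.0∈ (label e))
      ; +∈     = λ {x} {y} s t {e} {u} {v} j →
          I.resp (label e) (sum-diff (x u) (x v) (y u) (y v)) (I.+∈ (label e) (s j) (t j))
      ; *∈     = λ r {x} s {e} {u} {v} j →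
          I.resp (label e) (scale-diff r (x u) (x v)) (I.*∈ (label e) r (s j))
      }
      where
        open import Relation.Binary.Reasoning.Setoid setoid
        open import Algebra.Properties.Ring ring using (-‿distribʳ-*; -‿+-comm)
        open import Algebra.Properties.CommutativeSemigroup +-commutativeSemigroup using (interchange)

        sum-diff : ∀ a b a′ b′ → (a - b) + (a′ - b′) ≈ (a + a′) - (b + b′)
        sum-diff a b a′ b′ = ≈-trans (interchange a (- b) a′ (- b′)) (+-congˡ (-‿+-comm b b′))

        scale-diff : ∀ r a b → r * (a - b) ≈ r * a - r * b
        scale-diff r a b = ≈-trans (distribˡ r a (- b)) (+-congˡ (≈-sym (-‿distribʳ-* r b)))

    Spl : Module R (c ⊔ ℓ) ℓ
    Spl = toModule (FreeModule R #V) splines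

  module _ {G G′ : LabeledGraph g Label} where
    private
      module G  = LabeledGraph G
      module G′ = LabeledGraph G′

    Spl* : Contraction G G′ → Module.Carrierᴹ (Spl G′) → Module.Carrierᴹ (Spl G)
    Spl* φ (p , p-spline) = p ∘ vertexMap , λ {e} → spline {e}
      where
        open Contraction φ
        open ContractionProperties φ using (contracted; kept)

        spline : IsSpline G (p ∘ vertexMap)
        spline {e} {u} {v} j with map (inj₂ e) in eq
        ... | inj₂ e′ = subst (λ i → I.member i _) (map-label eq) (p-spline (kept j eq))
        ... | inj₁ v′ with contracted j eq
        ...   | u≡ , v≡ = I.resp (G.label e)
            (≈-sym (≈-trans (+-congˡ (-‿cong (reflexive (cong p (trans v≡ (sym u≡))))))
                            (-‿inverseʳ _)))
            (I.0∈ (G.label e))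

  SplModule : Noetherian R → OpModule R g Label (c ⊔ ℓ) ℓ
  SplModule noetherian = record
    { obj    = Spl
    ; obj-fg = λ G → NoetherianProperties.submodule-fg R noetherian (splines G)
    ; pullback = Spl*
    ; pullback-homomorphism = λ φ → record
      { isBimoduleHomomorphism = record
        { +ᴹ-isGroupHomomorphism = record
          { isMonoidHomomorphism = record
            { isMagmaHomomorphism = record
              { isRelHomomorphism = record { cong = λ p≈q v → p≈q _ }
              ; homo = λ _ _ _ → ≈-refl
              }
            ; ε-homo = λ _ → ≈-refl
            }
          ; ⁻¹-homo = λ _ _ → ≈-refl
          }
        ; *ₗ-homo = λ _ _ _ → ≈-refl
        ; *ᵣ-homo = λ _ _ _ → ≈-refl
        }
      }
    ; pullback-resp = λ {_} {_} {φ} {ψ} φ≗ψ (p , _) v → reflexive (cong p (inj₁-injective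
        (trans (sym (proj₂ (Contraction.map-vertex φ v)))
        (trans (φ≗ψ (inj₁ v)) (proj₂ (Contraction.map-vertex ψ v))))))
    ; pullback-identity = λ _ _ → ≈-refl
    ; pullback-⊚        = λ _ _ _ _ → ≈-refl
    }

{-# OPTIONS --safe #-}

-- Fix a spanning tree of G, so that all but g edges lie on it.  If the tree has
-- more than |S|·2^g edges, then two of its edges carry the same label and have
-- fundamental cuts meeting the same edges off the tree.  The symmetric
-- difference of the two cuts is then a cut δ(A) consisting of these two edges
-- only.  For a spline p with jump d along the first of them, d lies in their
-- common ideal, so d·1_A is a spline.  The spline p − d·1_A is constant along
-- the first edge, and d·1_A along any third tree edge, so both come from
-- contractions of one edge.  By induction the graphs with a bounded number of
-- vertices generate.
module Submission where

open import Defs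
open import Algebra.Bundles using (CommutativeRing)
open import Algebra.Module.Bundles using (Module)
open import Data.Bool.Base using (Bool; true; false; if_then_else_; _xor_)
open import Data.Bool.Properties using (xor-same; xor-comm; xor-∧-commutativeRing)
open import Data.Fin.Base using (Fin; zero; suc; punchIn; punchOut; combine; funToFin; finToFun)
open import Data.Fin.Properties
  using ( _≟_; any?; pigeonhole; combine-injective; finToFun-funToFin; punchIn-injective; punchInᵢ≢i
        ; punchIn-punchOut; punchOut-punchIn; punchOut-cong; suc-injective; <⇒≢; 2↔Bool)
open import Data.Integer.Base as ℤ using (+_; 1ℤ; _⊖_)
import Data.Integer.Properties as ℤ
open import Data.List.Base using (List; []; _∷_; concatMap; allFin; upTo)
open import Data.List.Membership.Propositional using (lose)
open import Data.List.Membership.Propositional.Properties using (∈-allFin; ∈-upTo⁺)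
open import Data.List.Relation.Unary.All as All using ([]; _∷_)
open import Data.List.Relation.Unary.AllPairs using (_∷_)
open import Data.List.Relation.Unary.Any as Any using (Any; here)
open import Data.List.Relation.Unary.Any.Properties using (concatMap⁺)
open import Data.Nat.Base as ℕ using (ℕ; zero; suc; _^_; _<_; _≤_; s≤s)
import Data.Nat.Properties as ℕ
open import Data.Product.Base using (∃-syntax; Σ-syntax; _×_; _,_; proj₁; proj₂)
open import Data.Sum.Base using (_⊎_; inj₁; inj₂)
open import Data.Sum.Properties using (inj₁-injective)
open import Data.Vec.Functional as Vector using (Vector)
open import Function.Base using (_∘_; id)
open import Function.Bundles using (Inverse; mk⇔)
open import Level using (_⊔_)
open import Relation.Binary.PropositionalEquality
  using (_≡_; _≢_; _≗_; refl; sym; trans; cong; cong₂; subst)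
open import Relation.Nullary using (¬_; Dec; yes; no; does; contradiction; ¬?; _×-dec_; _⊎-dec_)
open import Relation.Nullary.Decidable using (decidable-stable; dec-true; dec-false)
open import Relation.Unary using (Pred; U)

-- Arithmetic of the genus.

genus-⊖ : ∀ m n → (+ m) ℤ.- (+ suc n) ℤ.+ 1ℤ ≡ m ⊖ n
genus-⊖ m n = trans (cong (ℤ._+ 1ℤ) (ℤ.m-n≡m⊖n m (suc n)))
  (trans (ℤ.distribˡ-⊖-+-pos 1 m (suc n))
  (trans (cong (_⊖ suc n) (ℕ.+-comm m 1)) (ℤ.[1+m]⊖[1+n]≡m⊖n m n)))

⊖-nonneg : ∀ {m g} n → m ⊖ n ≡ + g → m ≡ n ℕ.+ g
⊖-nonneg {m}     zero    p = ℤ.+-injective p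
⊖-nonneg {zero}  (suc n) ()
⊖-nonneg {suc m} (suc n) p = cong suc (⊖-nonneg n (trans (sym (ℤ.[1+m]⊖[1+n]≡m⊖n m n)) p))

[n+g]⊖n≡g : ∀ n g → (n ℕ.+ g) ⊖ n ≡ + g
[n+g]⊖n≡g zero    g = refl
[n+g]⊖n≡g (suc n) g = trans (ℤ.[1+m]⊖[1+n]≡m⊖n (n ℕ.+ g) n) ([n+g]⊖n≡g n g)

-- Images of connected graphs.

module WalkImage (G H : Graph) where
  private
    module G = Graph G
    module H = Graph H

  module _ (f : G.Vertex → H.Vertex)
           (f-joins : ∀ {e u v} → G.Joins e u v → f u ≡ f v ⊎ ∃[ e′ ] H.Joins e′ (f u) (f v)) where

    image : ∀ {u v} → G.Walk u v → H.Walk (f u) (f v)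
    image G.nil = H.nil
    image {v = v} (G.cons e j w) with f-joins j
    ... | inj₁ fu≡fx     = subst (λ a → H.Walk a (f v)) (sym fu≡fx) (image w)
    ... | inj₂ (e′ , j′) = H.cons e′ j′ (image w)

    -- Walks map to walks, edges collapsed by `f` being skipped. This serves both for contracting an
    -- edge and for replacing the endpoints of a graph by pointwise equal ones.
    connected-image : (∀ v′ → ∃[ v ] f v ≡ v′) → G.IsConnected U → H.IsConnected U
    connected-image onto conn = record
      { inhabited = f (proj₁ inhabited) , _
      ; walk      = λ {u} {v} _ _ → walk′ (onto u) (onto v)
      }
      where
        open G.IsConnected conn
        walk′ : ∀ {u′ v′} → ∃[ u ] f u ≡ u′ → ∃[ v ] f v ≡ v′ →
                Σ[ w ∈ H.Walk u′ v′ ] w H.Within U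
        walk′ (u , refl) (v , refl) = image (proj₁ (walk {u} {v} _ _)) , All.tabulate _

-- Graphs with `n + 1` vertices and `n + g` edges.

module _ {g : ℕ} where

  -- A connected graph of genus g on n + 1 vertices has n + g edges.
  graphOf : ∀ n → (Fin (n ℕ.+ g) → Fin (suc n) × Fin (suc n)) → Graph
  graphOf n ends = record { #V = suc n ; #E = n ℕ.+ g ; ends = ends }

  genus-graphOf : ∀ n ends → Graph.genus (graphOf n ends) ≡ + g
  genus-graphOf n ends = trans (genus-⊖ (n ℕ.+ g) n) ([n+g]⊖n≡g n g)

module _ {g : ℕ} {L : Set} where

  -- The edge count `n + g` makes the removal of one vertex and one edge a step from `suc n` to `n`
  -- by computation. The genus equation is a field so that every labeled graph, with its own proof
  -- of it, has the form `presented P`.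
  record Presentation (n : ℕ) : Set where
    field
      ends      : Fin (n ℕ.+ g) → Fin (suc n) × Fin (suc n)
      connected : Graph.IsConnected (graphOf n ends) U
      genus≡g   : Graph.genus (graphOf n ends) ≡ + g
      label     : Fin (n ℕ.+ g) → L

    presented : LabeledGraph g L
    presented = record
      { graph = graphOf n ends ; connected = connected ; genus≡g = genus≡g ; label = label }

  open Presentation

  data Presented : LabeledGraph g L → Set where
    presentation : ∀ n (P : Presentation n) → Presented (presented P)

  -- A connected graph has a vertex, so `#V` is a successor, and the genus equation then fixes the
  -- number of edges.
  isPresented : ∀ G → Presented G
  isPresented record { graph = record { #V = zero } ; connected = conn }
    with () ← proj₁ (Graph.IsConnected.inhabited conn)
  isPresented record { graph = record { #V = suc n ; #E = m ; ends = ends } ; connected = conn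
                     ; genus≡g = gen ; label = label }
    with refl ← ⊖-nonneg {m} n (trans (sym (genus-⊖ m n)) gen) =
    presentation n record { ends = ends ; connected = conn ; genus≡g = gen ; label = label }

  module _ {n} {P Q : Presentation n} (ends≗ : ends P ≗ ends Q) (label≗ : label P ≗ label Q) where

    -- Links a graph to a copy whose endpoint and label functions agree with its own only pointwise,
    -- as happens when functions are recovered from a finite table.
    relabel : Contraction (presented P) (presented Q)
    relabel = record
      { map                = id
      ; map-vertex         = λ v → v , refl
      ; map-vertex-onto    = λ v → v , refl
      ; map-∂              = λ e v′ → mk⇔
          (λ { (v , v∈∂ , refl) → subst (λ (a , b) → v ≡ a ⊎ v ≡ b) (ends≗ e) v∈∂ })
          (λ v′∈∂ → v′ , subst (λ (a , b) → v′ ≡ a ⊎ v′ ≡ b) (sym (ends≗ e)) v′∈∂ , refl)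
      ; map-edge-bijective = λ e → e , refl , λ { refl → refl }
      ; map-label          = λ { {e} refl → sym (label≗ e) }
      ; fibre-subtree      = λ v → record
        { isSubgraph  = record { closed = λ () }
        ; isConnected = record
          { inhabited = v , refl
          ; walk      = λ { refl refl → Graph.nil , [] }
          }
        ; isAcyclic   = λ { Graph.nil c _ → Graph.IsCycle.nonempty c refl
                          ; (Graph.cons _ _ _) _ (() ∷ _) }
        }
      }

  -- Contraction of a single edge that is not a loop.

  module EdgeContraction {n} (P : Presentation (suc n)) (e : Fin (suc n ℕ.+ g))
                         (loopless : proj₁ (ends P e) ≢ proj₂ (ends P e)) where

    G : LabeledGraph g L
    G = presented P

    module G = LabeledGraph G

    a b : G.Vertex
    a = proj₁ (ends P e)
    b = proj₂ (ends P e)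

    -- The end `b` is dropped from the numbering and merged into `a`, so that `punchIn b` is a
    -- section of `π`.
    π : G.Vertex → Fin (suc n)
    π v with b ≟ v
    ... | yes _  = punchOut {i = b} {j = a} (loopless ∘ sym)
    ... | no b≢v = punchOut b≢v

    πb≡πa : π b ≡ π a
    πb≡πa with b ≟ b | b ≟ a
    ... | no b≢b | _       = contradiction refl b≢b
    ... | yes _  | yes b≡a = contradiction (sym b≡a) loopless
    ... | yes _  | no _    = punchOut-cong b refl

    π-punchIn : ∀ v → π (punchIn b v) ≡ v
    π-punchIn v with b ≟ punchIn b v
    ... | yes p = contradiction (sym p) (punchInᵢ≢i b v)
    ... | no _  = punchOut-punchIn b

    punchIn-π : ∀ v → punchIn b (π v) ≡ v ⊎ v ≡ b × punchIn b (π v) ≡ a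
    punchIn-π v with b ≟ v
    ... | yes b≡v = inj₂ (sym b≡v , punchIn-punchOut (loopless ∘ sym))
    ... | no b≢v  = inj₁ (punchIn-punchOut b≢v)

    -- Only `a` and `b` are identified, and `e` joins them. A fibre is therefore a single vertex or
    -- the edge `e` with its two ends.
    π-fibre : ∀ u v → π u ≡ π v → u ≡ v ⊎ G.Joins e u v
    π-fibre u v p with punchIn-π u | punchIn-π v | cong (punchIn b) p
    ... | inj₁ q        | inj₁ r        | s = inj₁ (trans (sym q) (trans s r))
    ... | inj₁ q        | inj₂ (r , r′) | s = inj₂ (inj₁ (cong₂ _,_ (trans (sym r′) (trans (sym s) q)) (sym r)))
    ... | inj₂ (q , q′) | inj₁ r        | s = inj₂ (inj₂ (cong₂ _,_ (trans (sym q′) (trans s r)) (sym q)))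
    ... | inj₂ (q , _)  | inj₂ (r , _)  | _ = inj₁ (trans q (sym r))

    ends/e : Fin (n ℕ.+ g) → Fin (suc n) × Fin (suc n)
    ends/e f = π (proj₁ (ends P (punchIn e f))) , π (proj₂ (ends P (punchIn e f)))

    module Q = Graph (graphOf n ends/e)

    edgeMap : G.Edge → Q.Cell
    edgeMap f with e ≟ f
    ... | yes _  = inj₁ (π a)
    ... | no e≢f = inj₂ (punchOut e≢f)

    map : G.Cell → Q.Cell
    map (inj₁ v) = inj₁ (π v)
    map (inj₂ f) = edgeMap f

    edgeMap-e : edgeMap e ≡ inj₁ (π a)
    edgeMap-e with e ≟ e
    ... | yes _  = refl
    ... | no e≢e = contradiction refl e≢e

    edgeMap-punchIn : ∀ f → edgeMap (punchIn e f) ≡ inj₂ f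
    edgeMap-punchIn f with e ≟ punchIn e f
    ... | yes p = contradiction (sym p) (punchInᵢ≢i e f)
    ... | no _  = cong inj₂ (punchOut-punchIn e)

    edgeMap-vertex : ∀ {f v} → edgeMap f ≡ inj₁ v → e ≡ f × π a ≡ v
    edgeMap-vertex {f} p with e ≟ f
    edgeMap-vertex refl | yes e≡f = e≡f , refl

    edgeMap-edge : ∀ {f f′} → edgeMap f ≡ inj₂ f′ → punchIn e f′ ≡ f
    edgeMap-edge {f} p with e ≟ f
    edgeMap-edge refl | no e≢f = punchIn-punchOut e≢f

    π-∂e : ∀ {v} → G.∂ (inj₂ e) v → π v ≡ π a
    π-∂e (inj₁ v≡a) = cong π v≡a
    π-∂e (inj₂ v≡b) = trans (cong π v≡b) πb≡πa

    edge-cases : ∀ f → e ≡ f ⊎ ∃[ f′ ] punchIn e f′ ≡ f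
    edge-cases f with e ≟ f
    ... | yes e≡f = inj₁ e≡f
    ... | no e≢f  = inj₂ (punchOut e≢f , punchIn-punchOut e≢f)

    ∂-to : ∀ f v′ → (∃[ v ] G.∂ (inj₂ f) v × map (inj₁ v) ≡ inj₁ v′) → Q.∂ (map (inj₂ f)) v′
    ∂-to f v′ (v , v∈∂f , refl) with edge-cases f
    ... | inj₁ refl rewrite edgeMap-e = π-∂e v∈∂f
    ... | inj₂ (f′ , refl) rewrite edgeMap-punchIn f′ = image v∈∂f
      where
        image : G.∂ (inj₂ (punchIn e f′)) v → Q.∂ (inj₂ f′) (π v)
        image (inj₁ p) = inj₁ (cong π p)
        image (inj₂ p) = inj₂ (cong π p)

    ∂-from : ∀ f v′ → Q.∂ (map (inj₂ f)) v′ → ∃[ v ] G.∂ (inj₂ f) v × map (inj₁ v) ≡ inj₁ v′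
    ∂-from f v′ v′∈∂ with edge-cases f
    ... | inj₁ refl rewrite edgeMap-e = a , inj₁ refl , cong inj₁ (sym v′∈∂)
    ... | inj₂ (f′ , refl) rewrite edgeMap-punchIn f′ with v′∈∂
    ...   | inj₁ p = _ , inj₁ refl , cong inj₁ (sym p)
    ...   | inj₂ p = _ , inj₂ refl , cong inj₁ (sym p)

    joins-π : ∀ {f u v} → G.Joins f u v → π u ≡ π v ⊎ ∃[ f′ ] Q.Joins f′ (π u) (π v)
    joins-π {f} j with edge-cases f
    joins-π (inj₁ refl) | inj₁ refl = inj₁ (sym πb≡πa)
    joins-π (inj₂ refl) | inj₁ refl = inj₁ πb≡πa
    joins-π (inj₁ p) | inj₂ (f′ , refl) = inj₂ (f′ , inj₁ (cong (λ (x , y) → π x , π y) p))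
    joins-π (inj₂ p) | inj₂ (f′ , refl) = inj₂ (f′ , inj₂ (cong (λ (x , y) → π x , π y) p))

    P/e : Presentation n
    P/e = record
      { ends      = ends/e
      ; connected = WalkImage.connected-image G.graph _ π joins-π (λ v′ → punchIn b v′ , π-punchIn v′)
                      (connected P)
      ; genus≡g   = genus-graphOf n ends/e
      ; label     = label P ∘ punchIn e
      }

    G/e : LabeledGraph g L
    G/e = presented P/e

    -- The only edge in a fibre is `e`: a cycle of one edge would make it a loop, and a longer cycle
    -- would use it twice.
    acyclic : ∀ v′ → G.IsAcyclic (λ x → map x ≡ inj₁ v′)
    acyclic v′ G.nil c _ = G.IsCycle.nonempty c refl
    acyclic v′ (G.cons f j G.nil) c (p ∷ []) with edgeMap-vertex p
    ... | refl , _ with j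
    ...   | inj₁ q = loopless (trans (cong proj₁ q) (cong proj₂ (sym q)))
    ...   | inj₂ q = loopless (trans (cong proj₁ q) (cong proj₂ (sym q)))
    acyclic v′ (G.cons f _ (G.cons f′ _ _)) c (p ∷ p′ ∷ _)
      with G.IsCycle.edgesUnique c
    ... | (f≢f′ ∷ _) ∷ _ = f≢f′ (trans (sym (proj₁ (edgeMap-vertex p))) (proj₁ (edgeMap-vertex p′)))

    contraction : Contraction G G/e
    contraction = record
      { map                = map
      ; map-vertex         = λ v → π v , refl
      ; map-vertex-onto    = λ v′ → punchIn b v′ , cong inj₁ (π-punchIn v′)
      ; map-∂              = λ f v′ → mk⇔ (∂-to f v′) (∂-from f v′)
      ; map-edge-bijective = λ f′ → punchIn e f′ , edgeMap-punchIn f′ , edgeMap-edge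
      ; map-label          = λ p → cong (label P) (edgeMap-edge p)
      ; fibre-subtree      = λ v′ → record
        { isSubgraph  = record { closed = λ p v∈∂ → closed p v∈∂ }
        ; isConnected = record
          { inhabited = punchIn b v′ , cong inj₁ (π-punchIn v′)
          ; walk      = λ {u} {v} → fibre-walk u v
          }
        ; isAcyclic   = acyclic v′
        }
      }
      where
        closed : ∀ {f v v′} → edgeMap f ≡ inj₁ v′ → G.∂ (inj₂ f) v → inj₁ (π v) ≡ inj₁ v′
        closed p v∈∂ with edgeMap-vertex p
        ... | refl , refl = cong inj₁ (π-∂e v∈∂)

        fibre-walk : ∀ u v {v′} → map (inj₁ u) ≡ inj₁ v′ → map (inj₁ v) ≡ inj₁ v′ →
                     Σ[ w ∈ G.Walk u v ] w G.Within (λ x → map x ≡ inj₁ v′)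
        fibre-walk u v refl q with π-fibre u v (sym (inj₁-injective q))
        ... | inj₁ refl = G.nil , []
        ... | inj₂ j    = G.cons e j G.nil , trans edgeMap-e (cong inj₁ (at j)) ∷ []
          where
            at : ∀ {u v} → G.Joins e u v → π a ≡ π u
            at (inj₁ p) = cong (π ∘ proj₁) p
            at (inj₂ p) = trans (sym πb≡πa) (cong (π ∘ proj₂) p)

-- Spanning trees and fundamental cuts.

module SpanningTree {n g} (ends : Fin (n ℕ.+ g) → Fin (suc n) × Fin (suc n)) where

  G : Graph
  G = record { #V = suc n ; #E = n ℕ.+ g ; ends = ends }

  open Graph G hiding (ends)

  crosses : (Vertex → Bool) → Edge → Bool
  crosses A e = A (proj₁ (ends e)) xor A (proj₂ (ends e))

  crosses-joins : ∀ A {e u v} → Joins e u v → crosses A e ≡ A u xor A v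
  crosses-joins A (inj₁ p) = cong (λ (x , y) → A x xor A y) p
  crosses-joins A {u = u} {v} (inj₂ p) =
    trans (cong (λ (x , y) → A x xor A y) p) (xor-comm (A v) (A u))

  -- A tree with k edges rooted at the vertex 0.  The set side i is the part of
  -- the tree cut off from the root by its i-th edge; its values outside the
  -- tree are irrelevant.
  record Tree (u k : ℕ) : Set where
    field
      outside           : Fin u → Vertex
      outside-injective : ∀ {i j} → outside i ≡ outside j → i ≡ j
      tree              : Fin k → Edge
      rest              : Fin (u ℕ.+ g) → Edge
      tree-or-rest      : ∀ e → (∃[ i ] tree i ≡ e) ⊎ (∃[ j ] rest j ≡ e)
      side              : Fin k → Vertex → Bool
      side-tree         : ∀ i j → crosses (side i) (tree j) ≡ does (i ≟ j)

    Reached : Vertex → Set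
    Reached v = ¬ (∃[ i ] outside i ≡ v)

    reached? : ∀ v → Dec (Reached v)
    reached? v = ¬? (any? λ i → outside i ≟ v)

    field
      root-reached : Reached zero
      tree-reached : ∀ {i v} → ∂ (inj₂ (tree i)) v → Reached v
      walk         : ∀ {v} → Reached v → Walk zero v

    LeavesBy : Vertex → Vertex → Set
    LeavesBy u v = Reached u × ¬ Reached v

    Leaving : Edge → Set
    Leaving e = LeavesBy (proj₁ (ends e)) (proj₂ (ends e)) ⊎ LeavesBy (proj₂ (ends e)) (proj₁ (ends e))

    leaving? : ∀ e → Dec (Leaving e)
    leaving? e = leavesBy? _ _ ⊎-dec leavesBy? _ _
      where
        leavesBy? : ∀ u v → Dec (LeavesBy u v)
        leavesBy? u v = reached? u ×-dec ¬? (reached? v)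

  open Tree

  snoc : ∀ {u v w} → Walk u v → ∀ e → Joins e v w → Walk u w
  snoc nil           e j = cons e j nil
  snoc (cons f i w) e j = cons f i (snoc w e j)

  root : Tree n 0
  root = record
    { outside           = suc
    ; outside-injective = suc-injective
    ; tree              = λ ()
    ; rest              = id
    ; tree-or-rest      = λ e → inj₂ (e , refl)
    ; side              = λ ()
    ; side-tree         = λ ()
    ; root-reached      = λ ()
    ; tree-reached      = λ { {()} }
    ; walk              = λ { {zero} _ → nil ; {suc v} ¬out → contradiction (v , refl) ¬out }
    }

  module Extend {u k} (T : Tree (suc u) k) {e x y} (j : Joins e x y)
                (x∈ : Reached T x) (i : Fin (suc u)) (i≡y : outside T i ≡ y) where

    y∉ : ¬ Reached T y
    y∉ y∈ = y∈ (i , i≡y)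

    outside′ : Fin u → Vertex
    outside′ = outside T ∘ punchIn i

    Reached′ : Vertex → Set
    Reached′ v = ¬ (∃[ l ] outside′ l ≡ v)

    grow : ∀ {v} → Reached T v → Reached′ v
    grow v∈ (l , p) = v∈ (punchIn i l , p)

    y∈′ : Reached′ y
    y∈′ (l , p) = punchInᵢ≢i i l (outside-injective T (trans p (sym i≡y)))

    reached-before : ∀ {v} → Reached′ v → v ≢ y → Reached T v
    reached-before v∈ v≢y (l , refl) with i ≟ l
    ... | yes refl = v≢y i≡y
    ... | no i≢l   = v∈ (punchOut i≢l , cong (outside T) (punchIn-punchOut i≢l))

    ∂e : ∀ {v} → ∂ (inj₂ e) v → v ≡ x ⊎ v ≡ y
    ∂e = go j
      where
        go : ∀ {v} → Joins e x y → ∂ (inj₂ e) v → v ≡ x ⊎ v ≡ y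
        go (inj₁ p) (inj₁ q) = inj₁ (trans q (cong proj₁ p))
        go (inj₁ p) (inj₂ q) = inj₂ (trans q (cong proj₂ p))
        go (inj₂ p) (inj₁ q) = inj₂ (trans q (cong proj₁ p))
        go (inj₂ p) (inj₂ q) = inj₁ (trans q (cong proj₂ p))

    ∂y : ∂ (inj₂ e) y
    ∂y = go j
      where
        go : Joins e x y → ∂ (inj₂ e) y
        go (inj₁ p) = inj₂ (cong proj₂ (sym p))
        go (inj₂ p) = inj₁ (cong proj₁ (sym p))

    -- Both ends of a tree edge are reached, whereas `y` is not, so `e` cannot be a tree edge.
    new : ∃[ l ] rest T l ≡ e
    new with tree-or-rest T e
    ... | inj₁ (_ , refl) = contradiction (tree-reached T ∂y) y∉
    ... | inj₂ r          = r

    tree′ : Fin (suc k) → Edge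
    tree′ zero    = e
    tree′ (suc l) = tree T l

    -- Deleting `e` keeps the count in step with the vertices outside, so that once none is left,
    -- only `g` edges are off the tree.
    rest′ : Fin (u ℕ.+ g) → Edge
    rest′ = rest T ∘ punchIn (proj₁ new)

    tree-or-rest′ : ∀ f → (∃[ l ] tree′ l ≡ f) ⊎ (∃[ l ] rest′ l ≡ f)
    tree-or-rest′ f with tree-or-rest T f
    ... | inj₁ (l , p) = inj₁ (suc l , p)
    ... | inj₂ (l , p) with proj₁ new ≟ l
    ...   | yes q = inj₁ (zero , trans (sym (proj₂ new)) (trans (cong (rest T) q) p))
    ...   | no q  = inj₂ (punchOut q , trans (cong (rest T) (punchIn-punchOut q)) p)

    -- The new leaf y is on the same side of every old edge as its neighbour x.
    side′ : Fin (suc k) → Vertex → Bool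
    side′ zero    v = does (v ≟ y)
    side′ (suc l) v = side T l (if does (v ≟ y) then x else v)

    x≢y : x ≢ y
    x≢y refl = y∉ x∈

    old : ∀ {l v} → ∂ (inj₂ (tree T l)) v → does (v ≟ y) ≡ false
    old {l} {v} v∈∂ = dec-false (v ≟ y) λ { refl → y∉ (tree-reached T v∈∂) }

    old′ : ∀ {l v} → ∂ (inj₂ (tree T l)) v → (if does (v ≟ y) then x else v) ≡ v
    old′ v∈∂ = cong (if_then x else _) (old v∈∂)

    -- Old tree edges do not meet `y`, so the new side does not separate their ends and the old
    -- sides are unchanged on them. On the new edge an old side takes its value at `x` twice.
    side-tree′ : ∀ l m → crosses (side′ l) (tree′ m) ≡ does (l ≟ m)
    side-tree′ zero    zero    = trans (crosses-joins (side′ zero) j)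
      (cong₂ _xor_ (dec-false (x ≟ y) x≢y) (dec-true (y ≟ y) refl))
    side-tree′ zero    (suc m) = cong₂ _xor_ (old (inj₁ refl)) (old (inj₂ refl))
    side-tree′ (suc l) zero    = trans (crosses-joins (side′ (suc l)) j)
      (trans (cong₂ (λ b c → side T l (if b then x else x) xor side T l (if c then x else y))
                    (dec-false (x ≟ y) x≢y) (dec-true (y ≟ y) refl))
             (xor-same (side T l x)))
    side-tree′ (suc l) (suc m) =
      trans (cong₂ (λ b c → side T l b xor side T l c) (old′ (inj₁ refl)) (old′ (inj₂ refl)))
            (side-tree T l m)

    tree-reached′ : ∀ {l v} → ∂ (inj₂ (tree′ l)) v → Reached′ v
    tree-reached′ {zero}  v∈∂ with ∂e v∈∂
    ... | inj₁ refl = grow x∈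
    ... | inj₂ refl = y∈′
    tree-reached′ {suc l} v∈∂ = grow (tree-reached T v∈∂)

    walk′ : ∀ {v} → Reached′ v → Walk zero v
    walk′ {v} v∈ with v ≟ y
    ... | yes refl = snoc (walk T x∈) e j
    ... | no v≢y   = walk T (reached-before v∈ v≢y)

    extended : Tree u (suc k)
    extended = record
      { outside           = outside′
      ; outside-injective = λ {l} {m} p → punchIn-injective i l m (outside-injective T p)
      ; tree              = tree′
      ; rest              = rest′
      ; tree-or-rest      = tree-or-rest′
      ; side              = side′
      ; side-tree         = side-tree′
      ; root-reached      = grow (root-reached T)
      ; tree-reached      = λ {l} → tree-reached′ {l}
      ; walk              = walk′
      }

  extend : ∀ {u k} (T : Tree (suc u) k) {e x y} → Joins e x y → LeavesBy T x y → Tree u (suc k)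
  extend T {y = y} j (x∈ , y∉) with decidable-stable (any? λ i → outside T i ≟ y) y∉
  ... | i , i≡y = Extend.extended T j x∈ i i≡y

  -- If no edge leaves the reached set, a walk from the root never leaves it, and so cannot end at a
  -- vertex outside.
  stuck : ∀ {u k} (T : Tree (suc u) k) → ¬ (∃[ e ] Leaving T e) → ¬ IsConnected U
  stuck T none conn =
    walk-stays (proj₁ (IsConnected.walk conn {zero} {outside T zero} _ _)) (root-reached T) (zero , refl)
    where
      stays : ∀ {e u v} → Joins e u v → Reached T u → Reached T v
      stays {e} {u} {v} j u∈ = decidable-stable (reached? T v) λ v∉ → none (e , leaving j v∉)
        where
          leaving : Joins e u v → ¬ Reached T v → Leaving T e
          leaving (inj₁ refl) v∉ = inj₁ (u∈ , v∉)
          leaving (inj₂ refl) v∉ = inj₂ (u∈ , v∉)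

      walk-stays : ∀ {u v} → Walk u v → Reached T u → Reached T v
      walk-stays nil          u∈ = u∈
      walk-stays (cons _ j w) u∈ = walk-stays w (stays j u∈)

  -- Each leaving edge absorbs one outside vertex. The second alternative turns the construction
  -- into a decision of connectedness, on which the enumeration of graphs relies.
  spanning : ∀ u {k} → Tree u k → Tree 0 (u ℕ.+ k) ⊎ ¬ IsConnected U
  spanning zero    T = inj₁ T
  spanning (suc u) {k} T with any? (leaving? T)
  ... | no none       = inj₂ (stuck T none)
  ... | yes (e , out) =
    subst (λ m → Tree 0 m ⊎ ¬ IsConnected U) (ℕ.+-suc u k) (spanning u (extend-by out))
    where
      extend-by : Leaving T e → Tree u (suc k)
      extend-by (inj₁ x→y) = extend T (inj₁ refl) x→y
      extend-by (inj₂ x→y) = extend T (inj₂ refl) x→y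

  spanning-tree : Tree 0 n ⊎ ¬ IsConnected U
  spanning-tree = subst (λ m → Tree 0 m ⊎ ¬ IsConnected U) (ℕ.+-identityʳ n) (spanning n root)

  tree-connected : ∀ {k} → Tree 0 k → IsConnected U
  tree-connected T = record
    { inhabited = zero , _
    ; walk      = λ {u} {v} _ _ → append (reverse (walk T {u} λ ())) (walk T {v} λ ()) , All.tabulate _
    }
    where
      append : ∀ {u v w} → Walk u v → Walk v w → Walk u w
      append nil          w′ = w′
      append (cons e j w) w′ = cons e j (append w w′)

      joins-sym : ∀ {e u v} → Joins e u v → Joins e v u
      joins-sym (inj₁ p) = inj₂ p
      joins-sym (inj₂ p) = inj₁ p

      reverse : ∀ {u v} → Walk u v → Walk v u
      reverse nil          = nil
      reverse (cons e j w) = snoc (reverse w) e (joins-sym j)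

  connected? : Dec (IsConnected U)
  connected? with spanning-tree
  ... | inj₁ T = yes (tree-connected T)
  ... | inj₂ ¬c = no ¬c

  connected-tree : IsConnected U → Tree 0 n
  connected-tree conn with spanning-tree
  ... | inj₁ T  = T
  ... | inj₂ ¬c = contradiction conn ¬c

  module SameCut (T : Tree 0 n) {i j} (i≢j : i ≢ j)
                 (same : ∀ l → crosses (side T i) (rest T l) ≡ crosses (side T j) (rest T l)) where

    A : Vertex → Bool
    A v = side T i v xor side T j v

    abstract
      -- Cuts are additive modulo 2 in the vertex set, so the cut of `A` is the symmetric difference
      -- of the two fundamental cuts.
      crosses-A : ∀ e → crosses A e ≡ crosses (side T i) e xor crosses (side T j) e
      crosses-A e = interchange (side T i _) (side T j _) (side T i _) (side T j _)
        where
          open import Algebra.Properties.CommutativeSemigroup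
            (CommutativeRing.+-commutativeSemigroup xor-∧-commutativeRing) using (interchange)

      crosses-i : crosses A (tree T i) ≡ true
      crosses-i = trans (crosses-A _) (cong₂ _xor_
        (trans (side-tree T i i) (dec-true (i ≟ i) refl))
        (trans (side-tree T j i) (dec-false (j ≟ i) (i≢j ∘ sym))))

      uncut : ∀ e → crosses (side T i) e ≡ crosses (side T j) e → crosses A e ≡ false
      uncut e p = trans (crosses-A e)
        (trans (cong (_xor crosses (side T j) e) p) (xor-same (crosses (side T j) e)))

      tree-uncut : ∀ {l} → i ≢ l → j ≢ l → crosses A (tree T l) ≡ false
      tree-uncut {l} i≢l j≢l = uncut (tree T l) (trans (off i≢l) (sym (off j≢l)))
        where
          off : ∀ {k} → k ≢ l → crosses (side T k) (tree T l) ≡ false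
          off {k} k≢l = trans (side-tree T k l) (dec-false (k ≟ l) k≢l)

      -- Off the tree the two fundamental cuts agree and cancel; on the tree each of them contains
      -- only its own edge.
      cut : ∀ e → crosses A e ≡ true → e ≡ tree T i ⊎ e ≡ tree T j
      cut e e∈δA = go (tree-or-rest T e)
        where
          true≢false : true ≢ false
          true≢false ()

          tree-edge : ∀ {l} → tree T l ≡ e → Dec (i ≡ l) → Dec (j ≡ l) → e ≡ tree T i ⊎ e ≡ tree T j
          tree-edge refl (yes refl) _          = inj₁ refl
          tree-edge refl (no _)     (yes refl) = inj₂ refl
          tree-edge refl (no i≢l)   (no j≢l)   =
            contradiction (trans (sym e∈δA) (tree-uncut i≢l j≢l)) true≢false

          go : (∃[ l ] tree T l ≡ e) ⊎ (∃[ l ] rest T l ≡ e) → e ≡ tree T i ⊎ e ≡ tree T j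
          go (inj₁ (l , p))    = tree-edge p (i ≟ l) (j ≟ l)
          go (inj₂ (l , refl)) = contradiction (trans (sym e∈δA) (uncut (rest T l) (same l))) true≢false

  -- `side T i` separates the ends of the `i`-th tree edge, which is impossible for a loop.
  tree-loopless : ∀ {u k} (T : Tree u k) i → proj₁ (ends (tree T i)) ≢ proj₂ (ends (tree T i))
  tree-loopless T i p with () ←
    trans (sym (trans (side-tree T i i) (dec-true (i ≟ i) refl)))
      (trans (cong (λ v → side T i v xor side T i (proj₂ (ends (tree T i)))) p)
             (xor-same (side T i (proj₂ (ends (tree T i))))))

open Presentation

-- Enumeration of the graphs of bounded size.

module Enumeration (g s : ℕ) where

  candidate : ∀ n → (Fin (n ℕ.+ g) → Fin (suc n) × Fin (suc n)) → (Fin (n ℕ.+ g) → Fin s) →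
              List (LabeledGraph g (Fin s))
  candidate n ends label with SpanningTree.connected? ends
  ... | yes conn = presented P ∷ []
    where
      P : Presentation n
      P = record { ends = ends ; connected = conn ; genus≡g = genus-graphOf n ends ; label = label }
  ... | no _     = []

  abstract
    -- The numbers `x`, `y` and `l` code the functions giving the first endpoints, the second
    -- endpoints and the labels of the edges.
    graphs : ℕ → List (LabeledGraph g (Fin s))
    graphs N =
      concatMap (λ n →
      concatMap (λ x →
      concatMap (λ y →
      concatMap (λ l → candidate n (λ e → finToFun x e , finToFun y e) (finToFun l))
        (allFin (s ^ (n ℕ.+ g)))) (allFin (suc n ^ (n ℕ.+ g)))) (allFin (suc n ^ (n ℕ.+ g)))) (upTo N)

    -- Decoding the code of a function returns it only up to pointwise equality, and a listed graph
    -- carries the connectedness proof found by `connected?`. Hence `C` is asked of every `Q` that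
    -- agrees with `P` pointwise.
    graphs-complete : ∀ {p} {C : Pred (LabeledGraph g (Fin s)) p} {N n} (P : Presentation n) → n < N →
      (∀ {Q : Presentation n} → ends P ≗ ends Q → label P ≗ label Q → C (presented Q)) → Any C (graphs N)
    graphs-complete {C = C} {n = n} P n<N C-Q =
      concatMap⁺ _ (lose (∈-upTo⁺ n<N) (
      concatMap⁺ _ (lose (∈-allFin (funToFin (proj₁ ∘ ends P))) (
      concatMap⁺ _ (lose (∈-allFin (funToFin (proj₂ ∘ ends P))) (
      concatMap⁺ _ (lose (∈-allFin (funToFin (label P)))
        (candidate-complete
          (λ e → sym (cong₂ _,_ (finToFun-funToFin (proj₁ ∘ ends P) e)
                                (finToFun-funToFin (proj₂ ∘ ends P) e)))
          (λ e → sym (finToFun-funToFin (label P) e))))))))))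
      where
        candidate-complete : ∀ {ends′ label′} → ends P ≗ ends′ → label P ≗ label′ →
          Any C (candidate n ends′ label′)
        candidate-complete {ends′} ends≗ label≗ with SpanningTree.connected? ends′
        ... | yes _  = here (C-Q ends≗ label≗)
        ... | no ¬c′ = contradiction
          (WalkImage.connected-image (graphOf n (ends P)) (graphOf n ends′) id joins (λ v → v , refl)
            (connected P)) ¬c′
          where
            joins : ∀ {e u v} → Graph.Joins (graphOf n (ends P)) e u v →
                    u ≡ v ⊎ ∃[ e′ ] Graph.Joins (graphOf n ends′) e′ u v
            joins {e} (inj₁ p) = inj₂ (e , inj₁ (trans (sym (ends≗ e)) p))
            joins {e} (inj₂ p) = inj₂ (e , inj₂ (trans (sym (ends≗ e)) p))

-- Pigeonhole principle for tree edges.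

third : ∀ {n} {i j : Fin n} → 3 ≤ n → i ≢ j → ∃[ l ] i ≢ l × j ≢ l
third {i = i} {j} (s≤s (s≤s (s≤s _))) i≢j =
  punchIn i k , punchInᵢ≢i i k ∘ sym ,
  λ j≡l → punchInᵢ≢i _ zero (punchIn-injective i _ _ (trans (sym j≡l) (sym (punchIn-punchOut i≢j))))
  -- Among the indices other than `i`, `punchOut i≢j` stands for `j`; `k` avoids it, and `3 ≤ n`
  -- leaves room for the `zero`.
  where k = punchIn (punchOut i≢j) zero

funToFin-injective : ∀ {m n} {f h : Fin m → Fin n} → funToFin f ≡ funToFin h → f ≗ h
funToFin-injective {f = f} {h} p i =
  trans (sym (finToFun-funToFin f i)) (trans (cong (λ c → finToFun c i) p) (finToFun-funToFin h i))

module _ {n g s} (ends : Fin (n ℕ.+ g) → Fin (suc n) × Fin (suc n)) (label : Fin (n ℕ.+ g) → Fin s) where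
  open SpanningTree ends
  open Tree

  -- The bits record which of the `g` edges off the tree lie in the fundamental cut of the `i`-th
  -- tree edge. Equal codes give both the common ideal and the hypothesis of `SameCut`.
  code : Tree 0 n → Fin n → Fin (s ℕ.* 2 ^ g)
  code T i = combine (label (tree T i)) (funToFin λ l → Inverse.from 2↔Bool (crosses (side T i) (rest T l)))

  cut-equivalent-edges : s ℕ.* 2 ^ g < n → (T : Tree 0 n) →
    ∃[ i ] ∃[ j ] i ≢ j × label (tree T i) ≡ label (tree T j) ×
                  ∀ l → crosses (side T i) (rest T l) ≡ crosses (side T j) (rest T l)
  cut-equivalent-edges big T with pigeonhole big (code T)
  ... | i , j , i<j , p with combine-injective (label (tree T i)) _ (label (tree T j)) _ p
  ...   | q , r = i , j , <⇒≢ i<j , q , λ l → bit-injective (funToFin-injective r l)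
    where
      bit-injective : ∀ {b c} → Inverse.from 2↔Bool b ≡ Inverse.from 2↔Bool c → b ≡ c
      bit-injective {b} {c} p = trans (sym (Inverse.strictlyInverseˡ 2↔Bool b))
        (trans (cong (Inverse.to 2↔Bool) p) (Inverse.strictlyInverseˡ 2↔Bool c))

-- Closure properties of spans.

module SpanProperties {c ℓ} {R : CommutativeRing c ℓ} {m ℓm} (M : Module R m ℓm) where
  open CommutativeRing R using (1#)
  open Module M

  span-resp : ∀ {p} {P : Pred Carrierᴹ p} {x y} → x ≈ᴹ y → Span M P x → Span M P y
  span-resp x≈y (n , r , z , z∈ , x≈) = n , r , z , z∈ , ≈ᴹ-trans (≈ᴹ-sym x≈y) x≈

  ∈-span : ∀ {p} {P : Pred Carrierᴹ p} {x} → P x → Span M P x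
  ∈-span {x = x} x∈ = 1 , (λ _ → 1#) , (λ _ → x) , (λ _ → x∈) ,
    ≈ᴹ-sym (≈ᴹ-trans (+ᴹ-identityʳ _) (*ₗ-identityˡ x))

  span-+ : ∀ {p} {P : Pred Carrierᴹ p} {x y} → Span M P x → Span M P y → Span M P (x +ᴹ y)
  span-+ {P = P} {x} {y} (n , r , z , z∈ , x≈) y∈ =
    span-resp {P = P} (+ᴹ-congʳ (≈ᴹ-sym x≈)) (go n r z z∈)
    where
      go : ∀ n r (z : Vector Carrierᴹ n) → (∀ i → P (z i)) → Span M P (linearCombination M r z +ᴹ y)
      go zero    r z z∈ = span-resp {P = P} (≈ᴹ-sym (+ᴹ-identityˡ y)) y∈
      go (suc n) r z z∈ with go n (r ∘ suc) (z ∘ suc) (z∈ ∘ suc)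
      ... | k , r′ , z′ , z′∈ , eq =
        suc k , r zero Vector.∷ r′ , z zero Vector.∷ z′ , (λ { zero → z∈ zero ; (suc i) → z′∈ i }) ,
        ≈ᴹ-trans (+ᴹ-assoc _ _ _) (+ᴹ-congˡ eq)

-- Splines: pullback, descent and generation.

module Splines {c ℓ} (R : CommutativeRing c ℓ) (S : FiniteSetOfIdeals R) {g : ℕ} where
  open CommutativeRing R hiding (zero; refl; sym; trans)
  open CommutativeRing R using () renaming (refl to ≈-refl; sym to ≈-sym; trans to ≈-trans)
  open FiniteSetOfIdeals S
  open import Algebra.Properties.Ring ring using (-0#≈0#)
  open import Algebra.Properties.AbelianGroup +-abelianGroup using (xyx⁻¹≈y; ⁻¹-anti-homo‿-)
  open import Relation.Binary.Reasoning.Setoid setoid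
  private
    module I i = Submodule (ideal i)
    Graphs = List (LabeledGraph g Label)
    Spline = λ (G : LabeledGraph g Label) → Module.Carrierᴹ (Spl R S G)

  FromList : Graphs → ∀ G → Spline G → Set (c ⊔ ℓ)
  FromList Gs G q =
    Any (λ G′ → Σ[ φ ∈ Contraction G G′ ] Σ[ p′ ∈ Spline G′ ] Module._≈ᴹ_ (Spl R S G) q (Spl* R S φ p′)) Gs

  Generated : Graphs → ∀ G → Spline G → Set (c ⊔ ℓ)
  Generated Gs G = Span (Spl R S G) (FromList Gs G)

  pullback-lc : ∀ {G G′} (φ : Contraction G G′) {n} (r : Vector Carrier n) (z : Vector (Spline G′) n) v →
    proj₁ (Spl* R S φ (linearCombination (Spl R S G′) r z)) v
      ≈ proj₁ (linearCombination (Spl R S G) r (Spl* R S φ ∘ z)) v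
  pullback-lc φ {zero}  r z v = ≈-refl
  pullback-lc φ {suc n} r z v = +-congˡ (pullback-lc φ (r ∘ suc) (z ∘ suc) v)

  -- `Spl*` is linear, and pulling back along `ψ` and then along `φ` is pulling back along `ψ ⊚ φ`.
  pullback-generated : ∀ {Gs G G′} (φ : Contraction G G′) {p} →
                       Generated Gs G′ p → Generated Gs G (Spl* R S φ p)
  pullback-generated φ (n , r , z , z∈ , p≈) =
    n , r , Spl* R S φ ∘ z ,
    (λ i → Any.map (λ (ψ , p′ , q≈) → ψ ⊚ φ , p′ , λ v → q≈ _) (z∈ i)) ,
    λ v → ≈-trans (p≈ _) (pullback-lc φ r z v)

  module Descent {n} (P : Presentation {g} {Label} (suc n)) (e : Fin (suc n ℕ.+ g))
                 (loopless : proj₁ (ends P e) ≢ proj₂ (ends P e)) where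
    open EdgeContraction P e loopless public

    -- Restriction along the section `punchIn b` gives `p′`. Equal values at the ends of `e` make
    -- `p` constant on the fibres of `π`, and the remaining edges keep their labels and differences.
    descend : (p : Spline G) → proj₁ p a ≈ proj₁ p b →
              Σ[ p′ ∈ Spline G/e ] (∀ v → proj₁ (Spl* R S contraction p′) v ≈ proj₁ p v)
    descend (p , p-spline) pa≈pb = (p ∘ punchIn b , λ {f} → spline {f}) , section
      where
        section : ∀ v → p (punchIn b (π v)) ≈ p v
        section v with punchIn-π v
        ... | inj₁ q         = reflexive (cong p q)
        ... | inj₂ (q , q′) = ≈-trans (reflexive (cong p q′)) (≈-trans pa≈pb (reflexive (cong p (sym q))))

        spline : IsSpline R S G/e (p ∘ punchIn b)
        spline {f} (inj₁ refl) = I.resp (LabeledGraph.label G/e f)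
          (+-cong (≈-sym (section _)) (-‿cong (≈-sym (section _)))) (p-spline (inj₁ refl))
        spline {f} (inj₂ refl) = I.resp (LabeledGraph.label G/e f)
          (+-cong (≈-sym (section _)) (-‿cong (≈-sym (section _)))) (p-spline (inj₂ refl))

  module Bump {n} (P : Presentation {g} {Label} n) (A : Fin (suc n) → Bool) (d : Carrier) where
    open LabeledGraph (presented P) using (Vertex)
    open SpanningTree (ends P) using (crosses; crosses-joins)

    bump : Vertex → Carrier
    bump v = if A v then d else 0#

    bump-constant : ∀ u v → A u xor A v ≡ false → bump u ≈ bump v
    bump-constant u v p with A u | A v
    ... | true  | true  = ≈-refl
    ... | false | false = ≈-refl

    abstract
      -- Along an edge `bump`, which is `d` times the indicator of `A`, changes by `d`, by `- d` or
      -- not at all, so only the edges of the cut impose a condition on `d`.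
      bump-spline : (∀ e → crosses A e ≡ true → I.member (label P e) d) → IsSpline R S (presented P) bump
      bump-spline d∈ {e} {u} {v} j with d∈ e | crosses-joins A j
      ... | d∈e | q rewrite q with A u | A v
      ...   | true  | true  = I.resp (label P e) (≈-sym (-‿inverseʳ d)) (I.0∈ (label P e))
      ...   | false | false = I.resp (label P e) (≈-sym (-‿inverseʳ 0#)) (I.0∈ (label P e))
      ...   | true  | false = I.resp (label P e) (≈-sym (≈-trans (+-congˡ -0#≈0#) (+-identityʳ d))) (d∈e refl)
      ...   | false | true  = I.resp (label P e) (≈-sym (+-identityˡ (- d)))
                                (-∈ _ (ideal (label P e)) (d∈e refl))

  relabel-spline : ∀ {n} (P Q : Presentation {g} {Label} n) → ends P ≗ ends Q → label P ≗ label Q →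
    ∀ {p} → IsSpline R S (presented P) p → IsSpline R S (presented Q) p
  relabel-spline P Q ends≗ label≗ p-spline {e} (inj₁ q) =
    subst (λ i → I.member i _) (label≗ e) (p-spline (inj₁ (trans (ends≗ e) q)))
  relabel-spline P Q ends≗ label≗ p-spline {e} (inj₂ q) =
    subst (λ i → I.member i _) (label≗ e) (p-spline (inj₂ (trans (ends≗ e) q)))

  x-[x-y]≈y-0 : ∀ x y → x - (x - y) ≈ y - 0#
  x-[x-y]≈y-0 x y = begin
    x + - (x + - y)     ≈⟨ +-congˡ (⁻¹-anti-homo‿- x y) ⟩
    x + (y + - x)       ≈⟨ +-assoc x y (- x) ⟨
    x + y + - x         ≈⟨ xyx⁻¹≈y x y ⟩
    y                   ≈⟨ +-identityʳ y ⟨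
    y + 0#              ≈⟨ +-congˡ -0#≈0# ⟨
    y + - 0#            ∎

  [x-y]+y≈x : ∀ x y → (x - y) + y ≈ x
  [x-y]+y≈x x y = ≈-trans (+-assoc x (- y) y) (≈-trans (+-congˡ (-‿inverseˡ y)) (+-identityʳ x))

  -- The value inside `A` minus the value outside, where `b` tells whether `x` is the value inside.
  -- With this sign, subtracting the bump levels the edge.
  difference : Bool → Carrier → Carrier → Carrier
  difference b x y = if b then x - y else y - x

  difference-levels : ∀ b c x y → b xor c ≡ true → let d = difference b x y in
    x - (if b then d else 0#) ≈ y - (if c then d else 0#)
  difference-levels true  false x y _ = x-[x-y]≈y-0 x y
  difference-levels false true  x y _ = ≈-sym (x-[x-y]≈y-0 y x)

  difference-member : ∀ b i {x y} → I.member i (x - y) → I.member i (y - x) →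
                      I.member i (difference b x y)
  difference-member true  i p q = p
  difference-member false i p q = q

  -- The condition under which a spline descends along the contraction of one edge. Loops are
  -- excluded, since a fibre containing one is not a tree.
  ConstantOnEdge : ∀ (G : LabeledGraph g Label) → Pred (Vector Carrier (LabeledGraph.#V G)) ℓ
  ConstantOnEdge G p =
    ∃[ e ] proj₁ (G.ends e) ≢ proj₂ (G.ends e) × p (proj₁ (G.ends e)) ≈ p (proj₂ (G.ends e))
    where module G = LabeledGraph G

  ConstantSum : ∀ G → Pred (Spline G) (c ⊔ ℓ)
  ConstantSum G p = Σ[ p₁ ∈ Spline G ] Σ[ p₂ ∈ Spline G ]
    p ≈ᴹ (p₁ +ᴹ p₂) × ConstantOnEdge G (proj₁ p₁) × ConstantOnEdge G (proj₁ p₂)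
    where open Module (Spl R S G)

  -- Splitting a spline into two that descend.

  module Decompose {n} (P : Presentation {g} {Label} n) (p : Spline (presented P)) where

    open SpanningTree (ends P) hiding (G)
    open Tree

    private
      G : LabeledGraph g Label
      G = presented P

    module _ (T : Tree 0 n) {i j l} (i≢j : i ≢ j) (i≢l : i ≢ l) (j≢l : j ≢ l)
             (same-label : label P (tree T i) ≡ label P (tree T j))
             (same : ∀ l → crosses (side T i) (rest T l) ≡ crosses (side T j) (rest T l)) where

      open SameCut T i≢j same

      private
        u w : Fin (suc n)
        u = proj₁ (ends P (tree T i))
        w = proj₂ (ends P (tree T i))

      d : Carrier
      d = difference (A u) (proj₁ p u) (proj₁ p w)

      open Bump P A d

      abstract
        -- The spline condition for `p` at `tree T i`, read in both directions, puts `d` into its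
        -- ideal whatever the sign; `same-label` carries this over to `tree T j`.
        d∈ : ∀ e → e ≡ tree T i ⊎ e ≡ tree T j → I.member (label P e) d
        d∈ e (inj₁ refl) = difference-member (A u) (label P e) (proj₂ p (inj₁ refl)) (proj₂ p (inj₂ refl))
        d∈ e (inj₂ refl) = subst (λ k → I.member k d) same-label (d∈ (tree T i) (inj₁ refl))

        q-spline : IsSpline R S G bump
        q-spline {e} = bump-spline (λ e e∈δA → d∈ e (cut e e∈δA)) {e}

        p-q-spline : IsSpline R S G (λ v → proj₁ p v - bump v)
        p-q-spline {e} = +∈ (proj₂ p) (-∈ (FreeModule R (suc n)) (splines R S G) λ {e} → q-spline {e}) {e}
          where open Submodule (splines R S G)

        p-q-constant : ConstantOnEdge G (λ v → proj₁ p v - bump v)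
        p-q-constant = tree T i , tree-loopless T i ,
          difference-levels (A u) (A w) (proj₁ p u) (proj₁ p w) crosses-i

        q-constant : ConstantOnEdge G bump
        q-constant = tree T l , tree-loopless T l ,
          bump-constant (proj₁ (ends P (tree T l))) (proj₂ (ends P (tree T l))) (tree-uncut i≢l j≢l)

        decomposition : ConstantSum G p
        decomposition = (_ , λ {e} → p-q-spline {e}) , (_ , λ {e} → q-spline {e}) ,
          (λ v → ≈-sym ([x-y]+y≈x (proj₁ p v) (bump v))) , p-q-constant , q-constant

  -- Induction on the number of vertices.

  bound : ℕ
  -- The number `n` of tree edges must exceed `size * 2 ^ g` for the pigeonhole principle and be at
  -- least 3 for the third tree edge.
  bound = 3 ℕ.+ size ℕ.* 2 ^ g

  decompose : ∀ {n} (P : Presentation {g} {Label} n) → bound ≤ n → ∀ p → ConstantSum (presented P) p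
  decompose P N≤n p =
    let T = SpanningTree.connected-tree (ends P) (connected P)
        i , j , i≢j , same-label , same =
          cut-equivalent-edges (ends P) (label P) (ℕ.<-≤-trans (ℕ.m<n+m _ ℕ.z<s) N≤n) T
        l , i≢l , j≢l = third (ℕ.≤-trans (ℕ.m≤m+n 3 _) N≤n) i≢j
    in Decompose.decomposition P p T i≢j i≢l j≢l same-label same

  AllGenerated : Graphs → ℕ → Set (c ⊔ ℓ)
  AllGenerated Gs n = ∀ (P : Presentation {g} {Label} n) p → Generated Gs (presented P) p

  -- The spline descends to a graph with one vertex fewer, where `ih` applies, and generation pulls
  -- back.
  constant-generated : ∀ Gs {n} → AllGenerated Gs n → ∀ (P : Presentation {g} {Label} (suc n)) p →
    ConstantOnEdge (presented P) (proj₁ p) → Generated Gs (presented P) p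
  constant-generated Gs ih P p (e , loopless , pa≈pb) =
    let p′ , p≈ = descend p pa≈pb in
    SpanProperties.span-resp (Spl R S G) {P = FromList Gs G} {Spl* R S contraction p′} {p} p≈
      (pullback-generated {Gs} contraction {p′} (ih P/e p′))
    where open Descent P e loopless

  module _ (Gs : Graphs) (small : ∀ {n} → n < bound → AllGenerated Gs n) where

    generated-step : ∀ {n} → AllGenerated Gs n → Dec (suc n < bound) → AllGenerated Gs (suc n)
    generated-step ih (yes n<N) = small n<N
    generated-step ih (no n≮N) P p =
      let G = presented P
          p₁ , p₂ , p≈ , p₁-constant , p₂-constant = decompose P (ℕ.≮⇒≥ n≮N) p
          open SpanProperties (Spl R S G)
          open Module (Spl R S G) using (_+ᴹ_)
      in span-resp {P = FromList Gs G} {p₁ +ᴹ p₂} {p} (λ v → ≈-sym (p≈ v))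
           (span-+ {P = FromList Gs G} {p₁} {p₂} (constant-generated Gs ih P p₁ p₁-constant)
                                                 (constant-generated Gs ih P p₂ p₂-constant))

    generated : ∀ n → AllGenerated Gs n
    generated zero    = small ℕ.z<s
    generated (suc n) = generated-step (generated n) (suc n ℕ.<? bound)

  generators : Graphs
  generators = Enumeration.graphs g size bound

  -- The graph is itself in the list up to pointwise equality, so each spline is the pullback of
  -- itself along `relabel`.
  small-generated : ∀ {n} → n < bound → AllGenerated generators n
  small-generated n<N P p =
    SpanProperties.∈-span (Spl R S G) {P = FromList generators G} {p}
      (Enumeration.graphs-complete g size P n<N λ {Q} ends≗ label≗ →
        relabel {P = P} {Q} ends≗ label≗ ,
        (proj₁ p , λ {e} → relabel-spline P Q ends≗ label≗ (proj₂ p) {e}) ,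
        λ _ → ≈-refl)
    where G = presented P

  presented-generated : ∀ {G} → Presented G → ∀ p → Generated generators G p
  presented-generated (presentation n P) = generated generators small-generated n P

theorem1p2 : ∀ {c ℓ} (R : CommutativeRing c ℓ) (noetherian : Noetherian R) (S : FiniteSetOfIdeals R) (g : ℕ) →
    let L = FiniteSetOfIdeals.Label S in
    OpModule.IsFinitelyGenerated (SplModule R S {g} noetherian)
    × (Σ[ Gs ∈ List (LabeledGraph g L) ]
    ((G : LabeledGraph g L) (p : Module.Carrierᴹ (Spl R S G)) →
    Span (Spl R S G)
    (λ q → Any (λ G′ → Σ[ φ ∈ Contraction G G′ ] Σ[ p′ ∈ Module.Carrierᴹ (Spl R S G′) ]
    Module._≈ᴹ_ (Spl R S G) q (Spl* R S φ p′)) Gs)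
    p))
-- The two claims unfold to the same type, so one proof serves for both.
theorem1p2 R noetherian S g = finite , finite
  where finite = generators , λ G → presented-generated (isPresented G)
          where open Splines R S {g}
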